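{- Let $p$ and $q$ be two fixed primes. Then: (1) if $p\equiv 3\pmod 4$ and $q\equiv 3\pmod 4$, then $H(p,q)=0$; (2) if $p=q\equiv 1\pmod 4$, then $H(p,q)=2$; (3) if $p\neq q$ and exactly one of $p$ and $q$ is $\equiv 3\pmod 4$, then $H(p,q)\le 2$; (4) if $p\neq q$ and both $p$ and $q$ are $\equiv 1\pmod 4$, then $H(p,q)\le 5$.
   Context: A Heron triangle is a (non-degenerate) triangle whose three side lengths and whose area are all positive integers. For positive integers $a,b$, $H(a,b)$ denotes the number of distinct positive integers $c$ such that $a,b,c$ are the side lengths of a Heron triangle. -}

module Defs where

open import Data.List using (List; filter; length; upTo)
open import Data.List.Membership.Propositional using (_∈_)
open import Data.List.Membership.Propositional.Properties
  using (∈-filter⁺; ∈-filter⁻; ∈-upTo⁺)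
open import Data.List.Relation.Unary.Unique.Propositional using (Unique)
import Data.List.Relation.Unary.Unique.Propositional.Properties as Unique
open import Data.Nat using (ℕ; suc; _+_; _*_; _∸_; _≤_; _<_; s≤s; >-nonZero; _≟_; _<?_)
open import Data.Nat.Properties using (anyUpTo?; ≤-trans; ≤-reflexive; m≤m*n; m≤n*m)
open import Data.Product using (_×_; _,_; proj₂; ∃-syntax)
open import Function using (_⇔_; mk⇔)
open import Relation.Binary.PropositionalEquality using (_≡_)
open import Relation.Nullary using (Dec)
open import Relation.Nullary.Decidable using (_×-dec_; map′)

-- Non-degenerate: the triangle inequalities are strict.
IsTriangle : ℕ → ℕ → ℕ → Set
IsTriangle a b c =
  (0 < a × 0 < b × 0 < c) × (a < b + c × b < a + c × c < a + b)

-- With s = (a + b + c) / 2, Heron's formula A² = s (s - a) (s - b) (s - c)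
-- for the area A, multiplied by 16.  No subtraction truncates when
-- IsTriangle a b c holds.
sixteenAreaSquared : ℕ → ℕ → ℕ → ℕ
sixteenAreaSquared a b c =
  (a + b + c) * (b + c ∸ a) * (a + c ∸ b) * (a + b ∸ c)

HasArea : ℕ → ℕ → ℕ → ℕ → Set
HasArea a b c A = 16 * (A * A) ≡ sixteenAreaSquared a b c

IsHeron : ℕ → ℕ → ℕ → Set
IsHeron a b c = IsTriangle a b c × ∃[ A ] (0 < A × HasArea a b c A)

isTriangle? : ∀ a b c → Dec (IsTriangle a b c)
isTriangle? a b c =
  ((0 <? a) ×-dec (0 <? b) ×-dec (0 <? c)) ×-dec
  ((a <? b + c) ×-dec (b <? a + c) ×-dec (c <? a + b))

-- An area is at most its square, which bounds the search.
hasPositiveArea? : ∀ a b c → Dec (∃[ A ] (0 < A × HasArea a b c A))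
hasPositiveArea? a b c =
  map′ (λ (A , _ , p) → A , p)
       (λ (A , 0<A , eq) → A , s≤s (bound A 0<A eq) , 0<A , eq)
       (anyUpTo? (λ A → (0 <? A) ×-dec (16 * (A * A) ≟ N)) (suc N))
  where
  N = sixteenAreaSquared a b c
  bound : ∀ A → 0 < A → 16 * (A * A) ≡ N → A ≤ N
  bound A 0<A eq =
    ≤-trans (m≤m*n A A {{>-nonZero 0<A}})
      (≤-trans (m≤n*m (A * A) 16) (≤-reflexive eq))

isHeron? : ∀ a b c → Dec (IsHeron a b c)
isHeron? a b c = isTriangle? a b c ×-dec hasPositiveArea? a b c

-- The range c < a + b loses nothing, by the triangle inequality; see
-- thirdSides-correct.
thirdSides : ℕ → ℕ → List ℕ
thirdSides a b = filter (isHeron? a b) (upTo (a + b))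

H : ℕ → ℕ → ℕ
H a b = length (thirdSides a b)

thirdSides-unique : ∀ a b → Unique (thirdSides a b)
thirdSides-unique a b = Unique.filter⁺ (isHeron? a b) (Unique.upTo⁺ (a + b))

thirdSides-correct : ∀ a b c → c ∈ thirdSides a b ⇔ IsHeron a b c
thirdSides-correct a b c = mk⇔
  (λ c∈ → proj₂ (∈-filter⁻ (isHeron? a b) {xs = upTo (a + b)} c∈))
  (λ { h@((_ , _ , _ , c<a+b) , _) →
       ∈-filter⁺ (isHeron? a b) (∈-upTo⁺ c<a+b) h })

{-# OPTIONS --safe #-}

-- A triangle with sides p, q, c and area A gives 2x = p² + q² − c² with
-- x² + (2A)² = (pq)², and c is determined by x.
--
-- If p is odd and divides x, then p divides c² − q², which forces the
-- semiperimeter to be a multiple jp, and the triangle inequalities become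
-- (j − 1)p < q < jp with j ≥ 2.  So p < q and c is unique.  A prime p ≡ 3 mod 4
-- always divides x, which settles (1) and (3).
--
-- For (4), p and q cannot both occur as such divisors, so at most one triangle
-- has x divisible by p or q.  For the others, p² divides x₁x₂ ± y₁y₂ for one
-- choice of sign, and likewise q².  If the two signs agree then |x₁| = |x₂|, so
-- three values of |x| are impossible, which leaves at most four values of x.
--
-- For (2), the triangle is two right triangles with hypotenuse p and legs d, h,
-- where c = 2d.  Zagier's proof of Fermat's two-square theorem provides the
-- legs, and the sign argument above shows that they are unique up to order.
module Submission where

open import Defs
open import Data.Nat using (ℕ; _≤_; _%_)
open import Data.Nat.Primality using (Prime)
open import Data.Product using (_×_; _,_)
open import Data.Sum using (_⊎_; inj₁; inj₂)
open import Relation.Binary.PropositionalEquality using (_≡_; _≢_; refl)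

-- Counting in duplicate-free lists.

module Counting where

  open import Data.Empty using (⊥; ⊥-elim)
  open import Data.List using (List; []; _∷_; _++_; filter; length)
  open import Data.List.Membership.Propositional using (_∈_)
  open import Data.List.Membership.Propositional.Properties using (∈-∃++; ∈-++⁻; ∈-++⁺ˡ; ∈-++⁺ʳ)
  open import Data.List.Properties using (length-++-sucʳ; filter-accept; filter-reject)
  open import Data.List.Relation.Unary.Any using (here; there)
  open import Data.List.Relation.Unary.All as All using (All; []; _∷_)
  open import Data.List.Relation.Unary.AllPairs using ([]; _∷_)
  open import Data.List.Relation.Unary.Unique.Propositional using (Unique)
  open import Data.Nat
  open import Data.Nat.Properties
  open import Data.Product using (_×_; _,_; ∃-syntax)
  open import Data.Sum using (inj₁; inj₂)
  open import Function using (_∘_)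
  open import Level using (Level)
  open import Relation.Binary using (tri<; tri≈; tri>)
  open import Relation.Binary.PropositionalEquality using (_≡_; _≢_; refl; sym; trans; cong)
  open import Relation.Nullary using (yes; no; contradiction)
  open import Relation.Nullary.Decidable using (¬?)
  open import Relation.Unary using (Decidable)

  private
    variable
      a b r : Level
      A : Set a
      B : Set b

  -- A relation takes the place of a function so that maps described by equations, such as `Step`
  -- below, need no formula with subtraction. The induction removes the partner of the head from
  -- `ys`; by injectivity no later element loses its partner.
  length-≤-by-injection : (R : A → B → Set r) → (∀ {x x′ y} → R x y → R x′ y → x ≡ x′) →
    ∀ {xs ys} → Unique xs → (∀ {x} → x ∈ xs → ∃[ y ] (y ∈ ys × R x y)) →
    length xs ≤ length ys
  length-≤-by-injection R inj {[]} _ _ = z≤n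
  length-≤-by-injection R inj {x ∷ xs} (x∉xs ∷ uniq) image
    with y , y∈ys , Rxy ← image (here refl)
    with as , bs , refl ← ∈-∃++ y∈ys =
      ≤-trans (s≤s (length-≤-by-injection R inj uniq image′))
              (≤-reflexive (sym (length-++-sucʳ as y bs)))
    where
    image′ : ∀ {x′} → x′ ∈ xs → ∃[ y′ ] (y′ ∈ as ++ bs × R x′ y′)
    image′ {x′} x′∈xs with y′ , y′∈ys , Rx′y′ ← image (there x′∈xs) with ∈-++⁻ as y′∈ys
    ... | inj₁ ∈as = y′ , ∈-++⁺ˡ ∈as , Rx′y′
    ... | inj₂ (there ∈bs) = y′ , ∈-++⁺ʳ as ∈bs , Rx′y′
    ... | inj₂ (here refl) = contradiction (inj Rxy Rx′y′) (All.lookup x∉xs x′∈xs)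

  length-≤-by-⊆ : ∀ {xs ys : List A} → Unique xs → (∀ {x} → x ∈ xs → x ∈ ys) → length xs ≤ length ys
  length-≤-by-⊆ uniq xs⊆ys =
    length-≤-by-injection _≡_ (λ p q → trans p (sym q)) uniq (λ {x} x∈xs → x , xs⊆ys x∈xs , refl)

  length-filter-¬ : ∀ {P : A → Set r} (P? : Decidable P) xs →
    length xs ≡ length (filter P? xs) + length (filter (¬? ∘ P?) xs)
  length-filter-¬ P? [] = refl
  length-filter-¬ P? (x ∷ xs) with P? x
  ... | yes _ = cong suc (length-filter-¬ P? xs)
  ... | no  _ = trans (cong suc (length-filter-¬ P? xs)) (sym (+-suc _ _))

  length-split-≤ : ∀ {P Q : A → Set r} (P? : Decidable P) (Q? : Decidable Q) xs {k l m} →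
    length (filter P? xs) ≤ k →
    length (filter Q? (filter (¬? ∘ P?) xs)) ≤ l →
    length (filter (¬? ∘ Q?) (filter (¬? ∘ P?) xs)) ≤ m →
    length xs ≤ k + (l + m)
  length-split-≤ P? Q? xs ≤k ≤l ≤m
    rewrite length-filter-¬ P? xs | length-filter-¬ Q? (filter (¬? ∘ P?) xs) = +-mono-≤ ≤k (+-mono-≤ ≤l ≤m)

  -- Meant for parity: if the two strict parts have equal size, the whole list has the parity of the
  -- middle part.
  length-filter-< : ∀ (f g : A → ℕ) xs → length xs ≡
    length (filter (λ x → f x <? g x) xs) +
    (length (filter (λ x → f x ≟ g x) xs) + length (filter (λ x → g x <? f x) xs))
  length-filter-< f g [] = refl
  length-filter-< f g (x ∷ xs) with <-cmp (f x) (g x)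
  ... | tri< lt ne ngt
    rewrite filter-accept (λ x → f x <? g x) {xs = xs} lt
          | filter-reject (λ x → f x ≟ g x) {xs = xs} ne
          | filter-reject (λ x → g x <? f x) {xs = xs} ngt = cong suc (length-filter-< f g xs)
  ... | tri≈ nlt eq ngt
    rewrite filter-reject (λ x → f x <? g x) {xs = xs} nlt
          | filter-accept (λ x → f x ≟ g x) {xs = xs} eq
          | filter-reject (λ x → g x <? f x) {xs = xs} ngt =
            trans (cong suc (length-filter-< f g xs)) (sym (+-suc _ _))
  ... | tri> nlt ne gt
    rewrite filter-reject (λ x → f x <? g x) {xs = xs} nlt
          | filter-reject (λ x → f x ≟ g x) {xs = xs} ne
          | filter-accept (λ x → g x <? f x) {xs = xs} gt =
            trans (cong suc (length-filter-< f g xs))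
              (trans (sym (+-suc _ _)) (cong (length (filter (λ x → f x <? g x) xs) +_) (sym (+-suc _ _))))

  length≤1 : ∀ {xs : List A} → Unique xs → (∀ {x y} → x ∈ xs → y ∈ xs → x ≡ y) → length xs ≤ 1
  length≤1 {xs = []} _ _ = z≤n
  length≤1 {xs = _ ∷ []} _ _ = s≤s z≤n
  length≤1 {xs = _ ∷ _ ∷ _} ((x≢y ∷ _) ∷ _) eq = contradiction (eq (here refl) (there (here refl))) x≢y

  length≤2 : ∀ {xs : List A} → Unique xs →
    (∀ {x y z} → x ∈ xs → y ∈ xs → z ∈ xs → x ≢ y → x ≢ z → y ≢ z → ⊥) → length xs ≤ 2
  length≤2 {xs = []} _ _ = z≤n
  length≤2 {xs = _ ∷ []} _ _ = s≤s z≤n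
  length≤2 {xs = _ ∷ _ ∷ []} _ _ = s≤s (s≤s z≤n)
  length≤2 {xs = _ ∷ _ ∷ _ ∷ _} ((x≢y ∷ x≢z ∷ _) ∷ (y≢z ∷ _) ∷ _) no-three =
    ⊥-elim (no-three (here refl) (there (here refl)) (there (there (here refl))) x≢y x≢z y≢z)

-- Residues modulo 4 and sums of two squares.

module Residues where

  open import Data.Empty using (⊥-elim)
  open import Data.Nat
  open import Data.Nat.Properties
  open import Data.Nat.Coprimality using (Coprime; coprime-Bézout; coprime-divisor; coprime-/gcd)
  open import Data.Nat.DivMod using (m≡m%n+[m/n]*n; m%n<n; m%n≤m; %-distribˡ-*; [m+kn]%n≡m%n; m/n*n≡m)
  open import Data.Nat.Divisibility
  open import Data.Nat.GCD using (gcd; module Bézout; gcd[m,n]∣m; gcd[m,n]∣n; gcd[m,n]≢0)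
  open import Data.Nat.Induction using (<-rec)
  open import Data.Nat.Primality using (Prime; prime⇒irreducible)
  open import Data.Nat.Tactic.RingSolver using (solve-∀)
  open import Data.Product using (_×_; _,_; ∃-syntax)
  open import Data.Sum using (_⊎_; inj₁; inj₂)
  open import Relation.Binary.PropositionalEquality
    using (_≡_; refl; sym; trans; cong; cong₂; subst; subst₂; module ≡-Reasoning)
  open import Relation.Nullary using (¬_; yes; no; contradiction)

  m<n⇒∃ : ∀ {m n} → m < n → ∃[ t ] (0 < t × n ≡ m + t)
  m<n⇒∃ {m} {n} m<n = n ∸ m , m<n⇒0<n∸m m<n , sym (m+[n∸m]≡n (<⇒≤ m<n))

  even-or-odd : ∀ n → ∃[ h ] (n ≡ 2 * h ⊎ n ≡ 1 + 2 * h)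
  even-or-odd zero = 0 , inj₁ refl
  even-or-odd (suc n) with even-or-odd n
  ... | h , inj₁ refl = h , inj₂ refl
  ... | h , inj₂ refl = suc h , inj₁ (sym (*-suc 2 h))

  odd⇒∃ : ∀ {n} → ¬ (2 ∣ n) → ∃[ m ] n ≡ 1 + 2 * m
  odd⇒∃ {n} odd with even-or-odd n
  ... | m , inj₁ refl = contradiction (m∣m*n m) odd
  ... | m , inj₂ n≡ = m , n≡

  -- If the residue r of `x` modulo `n` is odd, then n - r is an even root, because `n` is odd. The
  -- even root 2e is kept halved, so that its square is visibly a multiple of 4.
  even-root : ∀ n x → ¬ (2 ∣ n) → n ∣ x * x + 1 → ∃[ e ] (2 * e < n × n ∣ 4 * (e * e) + 1)
  even-root n x odd n∣ with m , refl ← odd⇒∃ odd =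
    reduce (x % n) (m%n<n x n) (∣m+n∣m⇒∣n (subst (n ∣_) shift n∣) (n∣m*n (q * q * n + 2 * (x % n) * q)))
    where
    q : ℕ
    q = x / n
    lemma : ∀ r a n → (r + a * n) * (r + a * n) + 1 ≡ (a * a * n + 2 * r * a) * n + (r * r + 1)
    lemma = solve-∀
    shift : x * x + 1 ≡ (q * q * n + 2 * (x % n) * q) * n + (x % n * (x % n) + 1)
    shift = trans (cong (λ t → t * t + 1) (m≡m%n+[m/n]*n x n)) (lemma (x % n) q n)
    reduce : ∀ r → r < n → n ∣ r * r + 1 → ∃[ e ] (2 * e < n × n ∣ 4 * (e * e) + 1)
    reduce r r<n n∣r²+1 with even-or-odd r
    ... | e , inj₁ refl = e , r<n , subst (n ∣_) (lemma₀ e) n∣r²+1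
      where
      lemma₀ : ∀ e → 2 * e * (2 * e) + 1 ≡ 4 * (e * e) + 1
      lemma₀ = solve-∀
    -- With n = 1 + 2m and r = 1 + 2e, the opposite root is n - r = 2(m - e) = 2d.
    ... | e , inj₂ refl with d , 0<d , refl ← m<n⇒∃ (*-cancelˡ-< 2 e m (≤-pred r<n)) =
      d , ≤-<-trans (*-monoʳ-≤ 2 (m≤n+m d e)) (n<1+n _)
        , ∣m+n∣m⇒∣n (subst (n ∣_) (lemma₁ e d) (∣m∣n⇒∣m+n n∣r²+1 (m∣m*n n))) (n∣m*n (2 * r))
      where
      lemma₁ : ∀ e d → (1 + 2 * e) * (1 + 2 * e) + 1 + (1 + 2 * (e + d)) * (1 + 2 * (e + d)) ≡
        2 * (1 + 2 * e) * (1 + 2 * (e + d)) + (4 * (d * d) + 1)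
      lemma₁ = solve-∀

  -- Modulo 4 the equation reads 3m ≡ 1, and 3 is its own inverse.
  cofactor-mod-4 : ∀ m n e → n % 4 ≡ 3 → 4 * (e * e) + 1 ≡ m * n → m % 4 ≡ 3
  cofactor-mod-4 m n e n%4≡3 eq = residue (m % 4) (m%n<n m 4) (begin
    (m % 4 * 3) % 4           ≡⟨ cong (λ t → (m % 4 * t) % 4) n%4≡3 ⟨
    (m % 4 * (n % 4)) % 4     ≡⟨ %-distribˡ-* m n 4 ⟨
    (m * n) % 4               ≡⟨ cong (_% 4) eq ⟨
    (4 * (e * e) + 1) % 4     ≡⟨ cong (_% 4) (lemma e) ⟩
    (1 + e * e * 4) % 4       ≡⟨ [m+kn]%n≡m%n 1 (e * e) 4 ⟩
    1                         ∎)
    where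
    open ≡-Reasoning
    lemma : ∀ e → 4 * (e * e) + 1 ≡ 1 + e * e * 4
    lemma = solve-∀
    residue : ∀ r → r < 4 → r * 3 % 4 ≡ 1 → r ≡ 3
    residue 3 _ _ = refl
    residue (suc (suc (suc (suc _)))) (s≤s (s≤s (s≤s (s≤s ())))) _

  odd-residue⇒odd : ∀ {n r} → ¬ (2 ∣ r) → n % 4 ≡ r → ¬ (2 ∣ n)
  odd-residue⇒odd 2∤r refl 2∣n = 2∤r (%-presˡ-∣ 2∣n (divides 2 refl))

  2∤1 : ¬ (2 ∣ 1)
  2∤1 d with () ← ∣1⇒≡1 d

  2∤3 : ¬ (2 ∣ 3)
  2∤3 d = 2∤1 (∣m+n∣m⇒∣n d (divides 1 refl))

  -- Descent: for an even root 2e < n of −1 modulo n, the cofactor of n in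
  -- (2e)² + 1 is again ≡ 3 mod 4, and smaller than n.
  n∤x²+1 : ∀ n → n % 4 ≡ 3 → ∀ x → ¬ (n ∣ x * x + 1)
  n∤x²+1 = <-rec _ step
    where
    step : ∀ n → (∀ {m} → m < n → m % 4 ≡ 3 → ∀ x → ¬ (m ∣ x * x + 1)) → n % 4 ≡ 3 → ∀ x → ¬ (n ∣ x * x + 1)
    step n rec n%4≡3 x n∣ with e , 2e<n , divides m eq ← even-root n x (odd-residue⇒odd {n} 2∤3 n%4≡3) n∣ =
      rec m<n (cofactor-mod-4 m n e n%4≡3 eq) (2 * e) (divides n (trans (lemma e) (trans eq (*-comm m n))))
      where
      lemma : ∀ e → 2 * e * (2 * e) + 1 ≡ 4 * (e * e) + 1
      lemma = solve-∀
      lemma₁ : ∀ e → 4 * (e * e) + 3 ≡ 2 * e * (2 * e) + 3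
      lemma₁ = solve-∀
      3≤n : 3 ≤ n
      3≤n = subst (_≤ n) n%4≡3 (m%n≤m n 4)
      open ≤-Reasoning
      m<n : m < n
      m<n = *-cancelʳ-< n m n (begin-strict
        m * n                 ≡⟨ eq ⟨
        4 * (e * e) + 1       <⟨ +-monoʳ-< (4 * (e * e)) (s≤s (s≤s z≤n)) ⟩
        4 * (e * e) + 3       ≡⟨ lemma₁ e ⟩
        2 * e * (2 * e) + 3   ≤⟨ +-mono-≤ (*-monoʳ-≤ (2 * e) (<⇒≤ 2e<n)) 3≤n ⟩
        2 * e * n + n         ≡⟨ +-comm (2 * e * n) n ⟩
        suc (2 * e) * n       ≤⟨ *-monoˡ-≤ n 2e<n ⟩
        n * n                 ∎)

  prime∤⇒coprime : ∀ {p n} → Prime p → ¬ (p ∣ n) → Coprime n p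
  prime∤⇒coprime pp p∤n (d∣n , d∣p) with prime⇒irreducible pp d∣p
  ... | inj₁ d≡1 = d≡1
  ... | inj₂ refl = contradiction d∣n p∤n

  -- Otherwise Bézout gives a with ay ≡ ±1 mod p, and multiplying the sum of squares by a² yields p
  -- ∣ (ax)² + 1, which `n∤x²+1` excludes.
  p∣x²+y²⇒p∣y : ∀ {p} x y → Prime p → p % 4 ≡ 3 → p ∣ x * x + y * y → p ∣ y
  p∣x²+y²⇒p∣y {p} x y pp p%4≡3 p∣ with p ∣? y
  ... | yes p∣y = p∣y
  ... | no p∤y with coprime-Bézout (prime∤⇒coprime pp p∤y)
  ...   | Bézout.+- a b 1+bp≡ay = ⊥-elim (n∤x²+1 p p%4≡3 (a * x)
            (∣m+n∣m⇒∣n (subst (p ∣_) eq (∣n⇒∣m*n (a * a) p∣)) (n∣m*n (b * b * p + 2 * b))))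
    where
    open ≡-Reasoning
    lemma₀ : ∀ a x y → a * a * (x * x + y * y) ≡ a * x * (a * x) + a * y * (a * y)
    lemma₀ = solve-∀
    lemma₁ : ∀ X b p → X + (1 + b * p) * (1 + b * p) ≡ (b * b * p + 2 * b) * p + (X + 1)
    lemma₁ = solve-∀
    eq : a * a * (x * x + y * y) ≡ (b * b * p + 2 * b) * p + (a * x * (a * x) + 1)
    eq = begin
      a * a * (x * x + y * y)                         ≡⟨ lemma₀ a x y ⟩
      a * x * (a * x) + a * y * (a * y)               ≡⟨ cong (λ t → a * x * (a * x) + t * t) 1+bp≡ay ⟨
      a * x * (a * x) + (1 + b * p) * (1 + b * p)     ≡⟨ lemma₁ (a * x * (a * x)) b p ⟩
      (b * b * p + 2 * b) * p + (a * x * (a * x) + 1) ∎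
  -- Here ay ≡ -1. Adding 2(1 + ay), a multiple of p, completes the square (1 + ay)² without
  -- negative numbers.
  ...   | Bézout.-+ a b 1+ay≡bp = ⊥-elim (n∤x²+1 p p%4≡3 (a * x)
            (∣m+n∣m⇒∣n (subst (p ∣_) eq (∣m∣n⇒∣m+n (∣n⇒∣m*n (a * a) p∣) (n∣m*n (2 * b))))
                (n∣m*n (b * b * p))))
    where
    open ≡-Reasoning
    lemma₀ : ∀ a x y → a * a * (x * x + y * y) + 2 * (1 + a * y) ≡ (1 + a * y) * (1 + a * y) +
        (a * x * (a * x) + 1)
    lemma₀ = solve-∀
    lemma₁ : ∀ X b p → b * p * (b * p) + X ≡ (b * b * p) * p + X
    lemma₁ = solve-∀
    eq : a * a * (x * x + y * y) + 2 * b * p ≡ b * b * p * p + (a * x * (a * x) + 1)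
    eq = begin
      a * a * (x * x + y * y) + 2 * b * p
          ≡⟨ cong (a * a * (x * x + y * y) +_) (*-assoc 2 b p) ⟩
      a * a * (x * x + y * y) + 2 * (b * p)
          ≡⟨ cong (λ t → a * a * (x * x + y * y) + 2 * t) 1+ay≡bp ⟨
      a * a * (x * x + y * y) + 2 * (1 + a * y)                   ≡⟨ lemma₀ a x y ⟩
      (1 + a * y) * (1 + a * y) + (a * x * (a * x) + 1)
          ≡⟨ cong (λ t → t * t + (a * x * (a * x) + 1)) 1+ay≡bp ⟩
      b * p * (b * p) + (a * x * (a * x) + 1)                     ≡⟨ lemma₁ (a * x * (a * x) + 1) b p ⟩
      b * b * p * p + (a * x * (a * x) + 1)                       ∎

  -- After division by the gcd, the coprime quotients m′ and n′ satisfy m′ ∣ n′ · n′, hence m′ ∣ n′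
  -- and m′ = 1. So m is the gcd itself.
  m²∣n²⇒m∣n : ∀ m n .{{_ : NonZero m}} → m * m ∣ n * n → m ∣ n
  m²∣n²⇒m∣n m n m²∣n² = subst (_∣ n)
      (trans (sym (*-identityˡ g)) (trans (cong (_* g) (sym m′≡1)) (m/n*n≡m g∣m))) g∣n
    where
    g : ℕ
    g = gcd m n
    g∣m = gcd[m,n]∣m m n
    g∣n = gcd[m,n]∣n m n
    instance
      g≢0 : NonZero g
      g≢0 = ≢-nonZero (gcd[m,n]≢0 m n (inj₁ (≢-nonZero⁻¹ m)))
    m′ n′ : ℕ
    m′ = m / g
    n′ = n / g
    lemma : ∀ u g → u * g * (u * g) ≡ u * u * (g * g)
    lemma = solve-∀
    m′²∣n′² : m′ * m′ ∣ n′ * n′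
    m′²∣n′² = *-cancelʳ-∣ (g * g) {{m*n≢0 g g}}
      (subst₂ _∣_ (trans (sym (cong₂ _*_ (m/n*n≡m g∣m) (m/n*n≡m g∣m))) (lemma m′ g))
                  (trans (sym (cong₂ _*_ (m/n*n≡m g∣n) (m/n*n≡m g∣n))) (lemma n′ g)) m²∣n²)
    coprime : Coprime m′ n′
    coprime = coprime-/gcd m n
    m′≡1 : m′ ≡ 1
    m′≡1 = coprime (∣-refl , coprime-divisor coprime (m*n∣⇒m∣ m′ m′ m′²∣n′²))

-- Zagier's involution and the two-square theorem.

module Windmills where

  open import Data.List using (List; []; _∷_; filter; length; upTo; cartesianProduct)
  open import Data.List.Membership.Propositional using (_∈_)
  open import Data.List.Membership.Propositional.Properties
    using (∈-length; ∈-filter⁺; ∈-filter⁻; ∈-upTo⁺; ∈-cartesianProduct⁺)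
  open import Data.List.Relation.Unary.Any using (here)
  open import Data.List.Relation.Unary.Unique.Propositional using (Unique)
  import Data.List.Relation.Unary.Unique.Propositional.Properties as Unique
  open import Data.Nat
  open import Data.Nat.Properties
  open import Data.Nat.DivMod using ([m+kn]%n≡m%n)
  open import Data.Nat.Divisibility using (divides; m∣m*n)
  open import Data.Nat.Primality using (Prime; prime⇒irreducible; ¬prime[0]; ¬prime[1])
  open import Data.Nat.Tactic.RingSolver using (solve-∀)
  open import Data.Product using (_×_; _,_; ∃-syntax; proj₂)
  open import Data.Sum using (_⊎_; inj₁; inj₂)
  open import Relation.Binary using (tri<; tri≈; tri>)
  open import Relation.Binary.PropositionalEquality
    using (_≡_; _≢_; refl; sym; trans; cong; cong₂; subst)
  open import Relation.Nullary using (¬_; contradiction)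
  open import Relation.Unary using (Decidable)
  open Residues
  open Counting

  square-not-prime : ∀ n → ¬ Prime (n * n)
  square-not-prime 0 = ¬prime[0]
  square-not-prime 1 = ¬prime[1]
  square-not-prime n@(2+ _) pp with prime⇒irreducible pp {n} (m∣m*n n)
  ... | inj₂ n≡n*n with () ← *-cancelˡ-≡ 1 n n (trans (*-identityʳ n) n≡n*n)

  module Windmill (p k : ℕ) (prime-p : Prime p) (p≡1+4k : p ≡ 1 + 4 * k) where

    Triple : Set
    Triple = ℕ × ℕ × ℕ

    -- Named after the picture of a square of side x with four y × z rectangles attached to it, of
    -- total area p.
    IsWindmill : Triple → Set
    IsWindmill (x , y , z) = x * x + 4 * (y * z) ≡ p

    4∤p : ∀ m → 4 * m ≢ p
    4∤p m eq with trans (sym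
        (trans (cong (_% 4) p≡1+4k) (trans (cong (λ t → (1 + t) % 4) (*-comm 4 k)) ([m+kn]%n≡m%n 1 k 4))))
                       (trans (cong (_% 4) (trans (sym eq) (*-comm 4 m))) ([m+kn]%n≡m%n 0 m 4))
    ... | ()

    square≢p : ∀ m → m * m ≢ p
    square≢p m eq = square-not-prime m (subst Prime (sym eq) prime-p)

    -- With x = 0 the prime p would be a multiple of 4, and with y = 0 or z = 0 it would be a
    -- square.
    windmill-positive : ∀ x y z → IsWindmill (x , y , z) → 0 < x × 0 < y × 0 < z
    windmill-positive zero y z e = contradiction e (4∤p (y * z))
    windmill-positive x@(suc _) zero z e = contradiction (trans (sym (+-identityʳ _)) e) (square≢p x)
    windmill-positive x@(suc _) y@(suc _) zero e =
      contradiction (trans (trans (sym (+-identityʳ _)) (cong (λ t → x * x + 4 * t) (sym (*-zeroʳ y)))) e)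
          (square≢p x)
    windmill-positive (suc _) (suc _) (suc _) e = z<s , z<s , z<s

    range : List ℕ
    range = upTo (suc p)

    windmill? : Decidable IsWindmill
    windmill? (x , y , z) = x * x + 4 * (y * z) ≟ p

    windmills : List Triple
    windmills = filter windmill? (cartesianProduct range (cartesianProduct range range))

    windmills-unique : Unique windmills
    windmills-unique = Unique.filter⁺ windmill?
      (Unique.cartesianProduct⁺ u (Unique.cartesianProduct⁺ u u))
      where u = Unique.upTo⁺ (suc p)

    -- Since the coordinates are positive, each is bounded by p, so the finite search misses no
    -- windmill.
    ∈-windmills : ∀ x y z → IsWindmill (x , y , z) → (x , y , z) ∈ windmills
    ∈-windmills x y z e with 0<x , 0<y , 0<z ← windmill-positive x y z e =
      ∈-filter⁺ windmill? (∈-cartesianProduct⁺ (∈-upTo⁺ (s≤s x≤p))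
        (∈-cartesianProduct⁺ (∈-upTo⁺ (s≤s y≤p)) (∈-upTo⁺ (s≤s z≤p)))) e
      where
      open ≤-Reasoning
      x≤p : x ≤ p
      x≤p = begin
        x                     ≤⟨ m≤m*n x x {{>-nonZero 0<x}} ⟩
        x * x                 ≤⟨ m≤m+n _ _ ⟩
        x * x + 4 * (y * z)   ≡⟨ e ⟩
        p                     ∎
      yz≤p : y * z ≤ p
      yz≤p = begin
        y * z                 ≤⟨ m≤n*m (y * z) 4 ⟩
        4 * (y * z)           ≤⟨ m≤n+m _ (x * x) ⟩
        x * x + 4 * (y * z)   ≡⟨ e ⟩
        p                     ∎
      y≤p : y ≤ p
      y≤p = ≤-trans (m≤m*n y z {{>-nonZero 0<z}}) yz≤p
      z≤p : z ≤ p
      z≤p = ≤-trans (m≤n*m z y {{>-nonZero 0<y}}) yz≤p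

    ∈-windmills⁻ : ∀ {t} → t ∈ windmills → IsWindmill t
    ∈-windmills⁻ t∈ = proj₂
        (∈-filter⁻ windmill? {xs = cartesianProduct range (cartesianProduct range range)} t∈)

    -- Zagier's involution, restricted to x < y (its values then have y′ < x′),
    -- with its branches written as linear relations free of subtraction.
    Step : Triple → Triple → Set
    Step (x , y , z) (x′ , y′ , z′) = (0 < x × 0 < z′) ×
      ( (x′ ≡ x + 2 * z × y′ ≡ z × y ≡ x + z + z′)
      ⊎ (y′ ≡ y × x′ + x ≡ 2 * y × z′ + y ≡ x + z))

    -- The two branches have disjoint images, with x′ > 2y′ in the first and x′ < 2y′ in the second:
    -- a common value would force x = 0.
    step-injective : ∀ {s s′ t} → Step s t → Step s′ t → s ≡ s′
    step-injective {x , _ , z} {x₂ , _ , _} (_ , inj₁ (e₁ , refl , refl)) (_ , inj₁ (e₂ , refl , refl))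
      with refl ← +-cancelʳ-≡ (2 * z) x x₂ (trans (sym e₁) e₂) = refl
    step-injective {x , y , z} {x₂ , _ , z₂} {x′ , _ , z′} (_ , inj₂ (refl , e₁ , f₁))
        (_ , inj₂ (refl , e₂ , f₂))
      with refl ← +-cancelˡ-≡ x′ x x₂ (trans e₁ (sym e₂))
      with refl ← +-cancelˡ-≡ x z z₂ (trans (sym f₁) f₂) = refl
    step-injective {x , y , z} {x₂ , _ , z₂} ((0<x , _) , inj₁ (refl , refl , _)) (_ , inj₂ (refl , e₂ , _)) =
      contradiction (m+n≡0⇒m≡0 x
          (m+n≡0⇒m≡0 (x + x₂) {0}
              (trans (+-identityʳ _) (+-cancelʳ-≡ (2 * z) (x + x₂) 0 (trans (lemma x z x₂) e₂))))) (>⇒≢ 0<x)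
      where
      lemma : ∀ x z x₂ → x + x₂ + 2 * z ≡ x + 2 * z + x₂
      lemma = solve-∀
    step-injective {x₂ , _ , z₂} {x , y , z} (_ , inj₂ (refl , e₂ , _)) ((0<x , _) , inj₁ (refl , refl , _)) =
      contradiction (m+n≡0⇒m≡0 x
          (m+n≡0⇒m≡0 (x + x₂) {0}
              (trans (+-identityʳ _) (+-cancelʳ-≡ (2 * z) (x + x₂) 0 (trans (lemma x z x₂) e₂))))) (>⇒≢ 0<x)
      where
      lemma : ∀ x z x₂ → x + x₂ + 2 * z ≡ x + 2 * z + x₂
      lemma = solve-∀

    -- This is injectivity of the converse relation, for counting in the other direction. The
    -- branches have disjoint domains, y > x + z and y < x + z, because z′ is positive.
    step-functional : ∀ {s t t′} → Step s t → Step s t′ → t ≡ t′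
    step-functional {x , y , z} {_ , _ , z₁} {_ , _ , z₂} (_ , inj₁ (refl , refl , e₁))
        (_ , inj₁ (refl , refl , e₂))
      with refl ← +-cancelˡ-≡ (x + z) z₁ z₂ (trans (sym e₁) e₂) = refl
    step-functional {x , y , z} {x₁ , _ , z₁} {x₂ , _ , z₂} (_ , inj₂ (refl , e₁ , f₁))
        (_ , inj₂ (refl , e₂ , f₂))
      with refl ← +-cancelʳ-≡ x x₁ x₂ (trans e₁ (sym e₂))
      with refl ← +-cancelʳ-≡ y z₁ z₂ (trans f₁ (sym f₂)) = refl
    step-functional {x , y , z} {x₁ , _ , z₁} {x₂ , _ , z₂} (_ , inj₁ (_ , _ , refl))
        ((_ , 0<z₂) , inj₂ (_ , _ , e)) =
      contradiction (m+n≡0⇒m≡0 z₂ (+-cancelʳ-≡ (x + z) _ _ (trans (lemma z₂ z₁ (x + z)) e))) (>⇒≢ 0<z₂)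
      where
      lemma : ∀ u v w → u + v + w ≡ u + (w + v)
      lemma = solve-∀
    step-functional {x , y , z} {x₂ , _ , z₂} {x₁ , _ , z₁} ((_ , 0<z₂) , inj₂ (_ , _ , e))
        (_ , inj₁ (_ , _ , refl)) =
      contradiction (m+n≡0⇒m≡0 z₂ (+-cancelʳ-≡ (x + z) _ _ (trans (lemma z₂ z₁ (x + z)) e))) (>⇒≢ 0<z₂)
      where
      lemma : ∀ u v w → u + v + w ≡ u + (w + v)
      lemma = solve-∀

    step-forward : ∀ x y z → IsWindmill (x , y , z) → x < y →
      ∃[ x′ ] ∃[ y′ ] ∃[ z′ ] (IsWindmill (x′ , y′ , z′) × y′ < x′ × Step (x , y , z) (x′ , y′ , z′))
    step-forward x y z e x<y with windmill-positive x y z e | <-cmp (x + z) y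
    -- On the boundary y = x + z between the branches, p would be the square (x + 2z)².
    ... | 0<x , _ , 0<z | tri≈ _ refl _ = contradiction (trans (lemma x z) e) (square≢p (x + 2 * z))
      where
      lemma : ∀ x z → (x + 2 * z) * (x + 2 * z) ≡ x * x + 4 * ((x + z) * z)
      lemma = solve-∀
    ... | 0<x , _ , 0<z | tri< lt _ _ with t , 0<t , refl ← m<n⇒∃ lt =
      x + 2 * z , z , t , trans (lemma x z t) e
        , <-≤-trans (m<n+m z 0<x) (+-monoʳ-≤ x (m≤n*m z 2)) , (0<x , 0<t) , inj₁ (refl , refl , refl)
      where
      lemma : ∀ x z t → (x + 2 * z) * (x + 2 * z) + 4 * (z * t) ≡ x * x + 4 * ((x + z + t) * z)
      lemma = solve-∀
    ... | 0<x , _ , 0<z | tri> _ _ gt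
      with u , 0<u , refl ← m<n⇒∃ x<y | w , 0<w , e′ ← m<n⇒∃ gt
      with refl ← +-cancelˡ-≡ x _ _ (trans e′ (+-assoc x u w)) =
      x + u + u , x + u , w , trans (lemma x u w) e , m<m+n (x + u) 0<u
        , (0<x , 0<w) , inj₂ (refl , lemma₁ x u , trans (+-comm w (x + u)) (+-assoc x u w))
      where
      lemma : ∀ x u w → (x + u + u) * (x + u + u) + 4 * ((x + u) * w) ≡ x * x + 4 * ((x + u) * (u + w))
      lemma = solve-∀
      lemma₁ : ∀ x u → x + u + u + x ≡ 2 * (x + u)
      lemma₁ = solve-∀

    step-backward : ∀ x′ y′ z′ → IsWindmill (x′ , y′ , z′) → y′ < x′ →
      ∃[ x ] ∃[ y ] ∃[ z ] (IsWindmill (x , y , z) × x < y × Step (x , y , z) (x′ , y′ , z′))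
    step-backward x′ y′ z′ e y′<x′
      with windmill-positive x′ y′ z′ e | m<n⇒∃ y′<x′
    ... | 0<x′ , 0<y′ , 0<z′ | u , 0<u , refl with <-cmp u y′
    -- On the boundary x′ = 2y′ between the images, p would be a multiple of 4.
    ... | tri≈ _ refl _ = contradiction (trans (lemma y′ z′) e) (4∤p (y′ * y′ + y′ * z′))
      where
      lemma : ∀ y z → 4 * (y * y + y * z) ≡ (y + y) * (y + y) + 4 * (y * z)
      lemma = solve-∀
    ... | tri> _ _ gt with x , 0<x , refl ← m<n⇒∃ gt =
      x , x + y′ + z′ , y′ , trans (lemma x y′ z′) e , ≤-trans (m<m+n x 0<y′) (m≤m+n _ z′)
        , (0<x , 0<z′) , inj₁ (lemma₁ x y′ , refl , refl)
      where
      lemma : ∀ x y z → x * x + 4 * ((x + y + z) * y) ≡ (y + (y + x)) * (y + (y + x)) + 4 * (y * z)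
      lemma = solve-∀
      lemma₁ : ∀ x y → y + (y + x) ≡ x + 2 * y
      lemma₁ = solve-∀
    ... | tri< lt _ _ with x , 0<x , refl ← m<n⇒∃ lt =
      x , u + x , u + z′ , trans (lemma x u z′) e , m<n+m x 0<u
        , (0<x , 0<z′) , inj₂ (refl , lemma₁ x u , lemma₂ x u z′)
      where
      lemma : ∀ x u z → x * x + 4 * ((u + x) * (u + z)) ≡ (u + x + u) * (u + x + u) + 4 * ((u + x) * z)
      lemma = solve-∀
      lemma₁ : ∀ x u → u + x + u + x ≡ 2 * (u + x)
      lemma₁ = solve-∀
      lemma₂ : ∀ x u z → z + (u + x) ≡ x + (u + z)
      lemma₂ = solve-∀

    π₁ π₂ π₃ : Triple → ℕ
    π₁ (x , _ , _) = x
    π₂ (_ , y , _) = y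
    π₃ (_ , _ , z) = z

    below above : (Triple → ℕ) → (Triple → ℕ) → List Triple
    below f g = filter (λ t → f t <? g t) windmills
    above f g = below g f
    level : (Triple → ℕ) → (Triple → ℕ) → List Triple
    level f g = filter (λ t → f t ≟ g t) windmills

    below-unique : ∀ f g → Unique (below f g)
    below-unique f g = Unique.filter⁺ (λ t → f t <? g t) windmills-unique

    ∈-below⁺ : ∀ f g x y z → IsWindmill (x , y , z) → f (x , y , z) < g (x , y , z) → (x , y , z) ∈ below f g
    ∈-below⁺ f g x y z e lt = ∈-filter⁺ (λ t → f t <? g t) (∈-windmills x y z e) lt

    ∈-below⁻ : ∀ f g {t} → t ∈ below f g → IsWindmill t × f t < g t
    ∈-below⁻ f g t∈ with t∈w , lt ← ∈-filter⁻ (λ t → f t <? g t) {xs = windmills} t∈ = ∈-windmills⁻ t∈w , lt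

    -- `Step` pairs off all windmills with x ≠ y, so only those with x = y matter for the parity.
    #x<y≡#y<x : length (below π₁ π₂) ≡ length (below π₂ π₁)
    #x<y≡#y<x = ≤-antisym
      (length-≤-by-injection Step step-injective (below-unique π₁ π₂) forward)
      (length-≤-by-injection (λ t s → Step s t) step-functional (below-unique π₂ π₁) backward)
      where
      forward : ∀ {s} → s ∈ below π₁ π₂ → ∃[ t ] (t ∈ below π₂ π₁ × Step s t)
      forward {x , y , z} s∈ with e , lt ← ∈-below⁻ π₁ π₂ s∈
        with x′ , y′ , z′ , e′ , gt , st ← step-forward x y z e lt =
        _ , ∈-below⁺ π₂ π₁ x′ y′ z′ e′ gt , st
      backward : ∀ {t} → t ∈ below π₂ π₁ → ∃[ s ] (s ∈ below π₁ π₂ × Step s t)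
      backward {x , y , z} t∈ with e , lt ← ∈-below⁻ π₂ π₁ t∈
        with x′ , y′ , z′ , e′ , gt , st ← step-backward x y z e lt =
        _ , ∈-below⁺ π₁ π₂ x′ y′ z′ e′ gt , st

    swap : Triple → Triple
    swap (x , y , z) = x , z , y

    swap-windmill : ∀ {x y z} → IsWindmill (x , y , z) → IsWindmill (x , z , y)
    swap-windmill {x} {y} {z} e = trans (cong (λ t → x * x + 4 * t) (*-comm z y)) e

    #y<z≡#z<y : length (below π₂ π₃) ≡ length (below π₃ π₂)
    #y<z≡#z<y = ≤-antisym
      (length-≤-by-injection _~_ swap-injective (below-unique π₂ π₃) forward)
      (length-≤-by-injection _~_ swap-injective (below-unique π₃ π₂) backward)
      where
      _~_ : Triple → Triple → Set
      s ~ t = t ≡ swap s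
      swap-injective : ∀ {s s′ t} → s ~ t → s′ ~ t → s ≡ s′
      swap-injective refl refl = refl
      forward : ∀ {s} → s ∈ below π₂ π₃ → ∃[ t ] (t ∈ below π₃ π₂ × s ~ t)
      forward {x , y , z} s∈ with e , lt ← ∈-below⁻ π₂ π₃ s∈ =
        _ , ∈-below⁺ π₃ π₂ x z y (swap-windmill {x} {y} e) lt , refl
      backward : ∀ {s} → s ∈ below π₃ π₂ → ∃[ t ] (t ∈ below π₂ π₃ × s ~ t)
      backward {x , y , z} s∈ with e , lt ← ∈-below⁻ π₃ π₂ s∈ =
        _ , ∈-below⁺ π₂ π₃ x z y (swap-windmill {x} {y} e) lt , refl

    -- Here p = x(x + 4z), so x is 1 or p. The first gives z = k, and the second makes the left side
    -- exceed p.
    x≡y⇒central : ∀ x z → IsWindmill (x , x , z) → (x , x , z) ≡ (1 , 1 , k)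
    x≡y⇒central x z e with prime⇒irreducible prime-p (divides (x + 4 * z) (trans (sym e) (lemma x z)))
      where
      lemma : ∀ x z → x * x + 4 * (x * z) ≡ (x + 4 * z) * x
      lemma = solve-∀
    ... | inj₁ refl with refl ← *-cancelˡ-≡ z k 4
          (suc-injective (trans (cong (λ t → 1 + 4 * t) (sym (*-identityˡ z))) (trans e p≡1+4k))) = refl
    ... | inj₂ refl with 0<p , _ , 0<z ← windmill-positive p p z e =
      contradiction (begin-strict
        p                     ≤⟨ m≤m*n p p {{>-nonZero 0<p}} ⟩
        p * p                 <⟨ m<m+n (p * p) (≤-trans (*-mono-≤ 0<p 0<z) (m≤n*m (p * z) 4)) ⟩
        p * p + 4 * (p * z)   ≡⟨ e ⟩
        p                     ∎) (<-irrefl refl)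
      where open ≤-Reasoning

    #x≡y≡1 : length (level π₁ π₂) ≡ 1
    #x≡y≡1 = ≤-antisym
      (length≤1 (Unique.filter⁺ (λ t → π₁ t ≟ π₂ t) windmills-unique)
        (λ s∈ t∈ → trans (central s∈) (sym (central t∈))))
      (∈-length (∈-filter⁺ (λ t → π₁ t ≟ π₂ t)
          (∈-windmills 1 1 k (trans (cong (λ t → 1 + 4 * t) (*-identityˡ k)) (sym p≡1+4k))) refl))
      where
      central : ∀ {t} → t ∈ level π₁ π₂ → t ≡ (1 , 1 , k)
      central {x , y , z} t∈ with t∈w , refl ← ∈-filter⁻ (λ t → π₁ t ≟ π₂ t) {xs = windmills} t∈ =
        x≡y⇒central x z (∈-windmills⁻ t∈w)

    -- Comparing x with y shows that the number of windmills is odd. Exchanging y and z pairs off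
    -- the windmills with y ≠ z, so one with y = z must exist.
    two-squares : ∃[ x ] ∃[ y ] (0 < x × 0 < y × x * x + 4 * (y * y) ≡ p)
    two-squares with level π₂ π₃ in eq
    ... | [] = contradiction (trans (lemma₀ n) (trans (sym even) (trans odd (lemma₁ m)))) (even≢odd n m)
      where
      m = length (below π₁ π₂)
      n = length (below π₂ π₃)
      lemma₀ : ∀ n → 2 * n ≡ n + n
      lemma₀ = solve-∀
      lemma₁ : ∀ m → m + (1 + m) ≡ 1 + 2 * m
      lemma₁ = solve-∀
      odd : length windmills ≡ length (below π₁ π₂) + (1 + length (below π₁ π₂))
      odd = trans (length-filter-< π₁ π₂ windmills)
        (cong (length (below π₁ π₂) +_) (cong₂ _+_ #x≡y≡1 (sym #x<y≡#y<x)))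
      even : length windmills ≡ length (below π₂ π₃) + length (below π₂ π₃)
      even = trans (length-filter-< π₂ π₃ windmills)
        (cong (length (below π₂ π₃) +_) (cong₂ _+_ (cong length eq) (sym #y<z≡#z<y)))
    ... | (x , y , z) ∷ _
      with t∈ , refl ← ∈-filter⁻ (λ t → π₂ t ≟ π₃ t) {xs = windmills}
          (subst ((x , y , z) ∈_) (sym eq) (here refl))
      with e ← ∈-windmills⁻ t∈
      with 0<x , 0<y , _ ← windmill-positive x y y e = x , y , 0<x , 0<y , e

-- Sums of two squares divisible by p², and the sign argument.

module Norms where

  open import Data.Integer hiding (suc; pred)
  open import Data.Integer.Properties
  open import Data.Integer.Divisibility.Signed
  open import Data.Integer.Tactic.RingSolver using (solve-∀)
  open import Data.Nat as ℕ using (ℕ; zero; suc)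
  import Data.Nat.Properties as ℕ
  import Data.Nat.Divisibility as ℕ
  open import Data.Nat.Primality
    using (Prime; euclidsLemma; prime[2]; ¬prime[0]; ¬prime[1]; prime⇒irreducible)
  open import Data.Product using (_,_; ∃-syntax)
  open import Data.Sign as Sign using (Sign)
  open import Data.Sum as Sum using (_⊎_; inj₁; inj₂)
  open import Function using (_∘_)
  open import Relation.Binary.PropositionalEquality
    using (_≡_; _≢_; refl; sym; trans; cong; cong₂; subst; module ≡-Reasoning)
  open import Relation.Nullary using (¬_; yes; no; contradiction)

  square : ∀ i → i * i ≡ + (∣ i ∣ ℕ.* ∣ i ∣)
  square (+ n) = sym (pos-* n n)
  square -[1+ n ] = refl

  p∤q : ∀ {p q} → Prime p → Prime q → p ≢ q → ¬ (p ℕ.∣ q)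
  p∤q pp pq p≢q p∣q with prime⇒irreducible pq p∣q
  ... | inj₁ refl = ¬prime[1] pp
  ... | inj₂ refl = p≢q refl

  prime∣*⇒∣⊎∣ : ∀ {p} → Prime p → ∀ i j → + p ∣ i * j → (+ p ∣ i) ⊎ (+ p ∣ j)
  prime∣*⇒∣⊎∣ {p} pp i j p∣ij =
    Sum.map ∣ᵤ⇒∣ ∣ᵤ⇒∣ (euclidsLemma ∣ i ∣ ∣ j ∣ pp (subst (p ℕ.∣_) (abs-* i j) (∣⇒∣ᵤ p∣ij)))

  prime∣²⇒∣ : ∀ {p} → Prime p → ∀ i → + p ∣ i * i → + p ∣ i
  prime∣²⇒∣ pp i p∣i² = Sum.reduce (prime∣*⇒∣⊎∣ pp i i p∣i²)

  -- Euclid's lemma is applied twice, moving one factor p into k each time.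
  p²∣mk⇒p²∣k : ∀ {p} → Prime p → ∀ m k → ¬ (+ p ∣ m) → + p * + p ∣ m * k → + p * + p ∣ k
  p²∣mk⇒p²∣k {zero} pp = contradiction pp ¬prime[0]
  p²∣mk⇒p²∣k {p@(suc _)} pp m k p∤m (divides t mk≡)
    with prime∣*⇒∣⊎∣ pp m k (divides (t * + p) (trans mk≡ (sym (*-assoc t (+ p) (+ p)))))
  ... | inj₁ p∣m = contradiction p∣m p∤m
  ... | inj₂ (divides s refl)
    with prime∣*⇒∣⊎∣ pp m s (divides t (*-cancelʳ-≡ (m * s) (t * + p) (+ p)
           (trans (*-assoc m s (+ p)) (trans mk≡ (sym (*-assoc t (+ p) (+ p)))))))
  ... | inj₁ p∣m = contradiction p∣m p∤m
  ... | inj₂ (divides r refl) = divides r (*-assoc r (+ p) (+ p))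

  -- Write k = s · p². As q does not divide p², the factor q² must divide s.
  p²∣k∧q²∣k⇒p²q²∣k : ∀ {p q} → Prime p → Prime q → p ≢ q → ∀ k →
    + p * + p ∣ k → + q * + q ∣ k → (+ p * + q) * (+ p * + q) ∣ k
  p²∣k∧q²∣k⇒p²q²∣k {p} {q} pp pq p≢q _ (divides s refl) q²∣k
    with divides r refl ← p²∣mk⇒p²∣k pq (+ p * + p) s (p∤q pq pp (p≢q ∘ sym) ∘ ∣⇒∣ᵤ ∘ prime∣²⇒∣ pq (+ p))
        (subst (+ q * + q ∣_) (*-comm s (+ p * + p)) q²∣k) =
    divides r (lemma r (+ p) (+ q))
    where
    lemma : ∀ r p q → r * (q * q) * (p * p) ≡ r * ((p * q) * (p * q))
    lemma = solve-∀

  ⟦_⟧ : Sign → ℤ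
  ⟦ s ⟧ = s ◃ 1

  ⟦⟧²≡1 : ∀ s → ⟦ s ⟧ * ⟦ s ⟧ ≡ 1ℤ
  ⟦⟧²≡1 Sign.+ = refl
  ⟦⟧²≡1 Sign.- = refl

  -- With S and T for the plus and minus forms, ST = x₁²(x₂² + y₂²) - y₂²(x₁² + y₁²) is a multiple
  -- of p². Since S + T = 2x₁x₂ is prime to p, one factor is prime to p and p² divides the other.
  -- The sign tells whether the same Gaussian prime above p divides x₁ + iy₁ and x₂ + iy₂, or
  -- conjugate ones.
  relative-sign : ∀ {p} → Prime p → ¬ (2 ℕ.∣ p) → ∀ x₁ y₁ x₂ y₂ → ¬ (+ p ∣ x₁) → ¬ (+ p ∣ x₂) →
    + p * + p ∣ x₁ * x₁ + y₁ * y₁ → + p * + p ∣ x₂ * x₂ + y₂ * y₂ →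
    ∃[ s ] + p * + p ∣ x₁ * x₂ + ⟦ s ⟧ * (y₁ * y₂)
  relative-sign {p} pp odd x₁ y₁ x₂ y₂ p∤x₁ p∤x₂ (divides t₁ e₁) (divides t₂ e₂)
    with + p ∣? x₁ * x₂ + 1ℤ * (y₁ * y₂)
  ... | no p∤S = Sign.- , p²∣mk⇒p²∣k pp _ _ p∤S p²∣ST
    where
    lemma : ∀ x₁ y₁ x₂ y₂ → (x₁ * x₂ + 1ℤ * (y₁ * y₂)) * (x₁ * x₂ + -1ℤ * (y₁ * y₂)) ≡
      x₁ * x₁ * (x₂ * x₂ + y₂ * y₂) - y₂ * y₂ * (x₁ * x₁ + y₁ * y₁)
    lemma = solve-∀
    p²∣ST : + p * + p ∣ (x₁ * x₂ + 1ℤ * (y₁ * y₂)) * (x₁ * x₂ + -1ℤ * (y₁ * y₂))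
    p²∣ST = subst (+ p * + p ∣_) (sym (lemma x₁ y₁ x₂ y₂))
      (∣m∣n⇒∣m-n (∣n⇒∣m*n (x₁ * x₁) (divides t₂ e₂)) (∣n⇒∣m*n (y₂ * y₂) (divides t₁ e₁)))
  ... | yes p∣S = Sign.+ , p²∣mk⇒p²∣k pp _ _ p∤T p²∣TS
    where
    lemma : ∀ x₁ y₁ x₂ y₂ → (x₁ * x₂ + -1ℤ * (y₁ * y₂)) * (x₁ * x₂ + 1ℤ * (y₁ * y₂)) ≡
      x₁ * x₁ * (x₂ * x₂ + y₂ * y₂) - y₂ * y₂ * (x₁ * x₁ + y₁ * y₁)
    lemma = solve-∀
    lemma₁ : ∀ u v → (u + 1ℤ * v) + (u + -1ℤ * v) ≡ + 2 * u
    lemma₁ = solve-∀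
    p²∣TS : + p * + p ∣ (x₁ * x₂ + -1ℤ * (y₁ * y₂)) * (x₁ * x₂ + 1ℤ * (y₁ * y₂))
    p²∣TS = subst (+ p * + p ∣_) (sym (lemma x₁ y₁ x₂ y₂))
      (∣m∣n⇒∣m-n (∣n⇒∣m*n (x₁ * x₁) (divides t₂ e₂)) (∣n⇒∣m*n (y₂ * y₂) (divides t₁ e₁)))
    p∤2 : ¬ (+ p ∣ + 2)
    p∤2 p∣2 = p∤q pp prime[2] (λ { refl → odd ℕ.∣-refl }) (∣⇒∣ᵤ p∣2)
    p∤T : ¬ (+ p ∣ x₁ * x₂ + -1ℤ * (y₁ * y₂))
    p∤T p∣T with prime∣*⇒∣⊎∣ pp (+ 2) (x₁ * x₂)
        (subst (+ p ∣_) (lemma₁ (x₁ * x₂) (y₁ * y₂)) (∣m∣n⇒∣m+n p∣S p∣T))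
    ... | inj₁ p∣2 = p∤2 p∣2
    ... | inj₂ p∣x₁x₂ = Sum.[ p∤x₁ , p∤x₂ ] (prime∣*⇒∣⊎∣ pp x₁ x₂ p∣x₁x₂)

  -- Signs relative to a common first pair compose: x₁² times the new expression is a combination of
  -- the three given multiples of p², and x₁² is prime to p.
  relative-sign-* : ∀ {p} → Prime p → ∀ s t x₁ y₁ x₂ y₂ x₃ y₃ → ¬ (+ p ∣ x₁) → + p * + p ∣ x₁ * x₁ + y₁ * y₁ →
    + p * + p ∣ x₁ * x₂ + ⟦ s ⟧ * (y₁ * y₂) → + p * + p ∣ x₁ * x₃ + ⟦ t ⟧ * (y₁ * y₃) →
    + p * + p ∣ x₂ * x₃ + ⟦ s Sign.* t ⟧ * (y₂ * y₃)
  relative-sign-* {p} pp s t x₁ y₁ x₂ y₂ x₃ y₃ p∤x₁ n₁ d₂ d₃ =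
    subst (λ u → + p * + p ∣ x₂ * x₃ + u * (y₂ * y₃)) (sym (◃-distrib-* s t 1 1))
      (p²∣mk⇒p²∣k pp (x₁ * x₁) _ (p∤x₁ ∘ prime∣²⇒∣ pp x₁)
        (subst (+ p * + p ∣_) (sym (lemma ⟦ s ⟧ ⟦ t ⟧ x₁ y₁ x₂ y₂ x₃ y₃))
          (∣m∣n⇒∣m+n (∣m∣n⇒∣m-n (∣n⇒∣m*n (x₁ * x₃) d₂) (∣n⇒∣m*n (⟦ s ⟧ * (y₁ * y₂)) d₃))
              (∣n⇒∣m*n (⟦ s ⟧ * ⟦ t ⟧ * (y₂ * y₃)) n₁))))
    where
    lemma : ∀ s t x₁ y₁ x₂ y₂ x₃ y₃ → x₁ * x₁ * (x₂ * x₃ + s * t * (y₂ * y₃)) ≡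
      x₁ * x₃ * (x₁ * x₂ + s * (y₁ * y₂)) - s * (y₁ * y₂) * (x₁ * x₃ + t * (y₁ * y₃)) + s * t * (y₂ * y₃) *
          (x₁ * x₁ + y₁ * y₁)
    lemma = solve-∀

  -- A nonzero integer k already has k²M² ≥ M², which leaves nothing for t².
  unit-circle : ∀ k t M → k * k * (M * M) + t * t ≡ M * M → k ≡ 0ℤ ⊎ t ≡ 0ℤ
  unit-circle k t M eq with ∣ k ∣ in ∣k∣≡ | square k
  ... | zero  | _ = inj₁ (∣i∣≡0⇒i≡0 ∣k∣≡)
  ... | suc j | k²≡ = inj₂ (∣i∣≡0⇒i≡0 (Sum.reduce (ℕ.m*n≡0⇒m≡0∨n≡0 ∣ t ∣ t²≡0)))
    where
    a b c : ℕ
    a = suc j ℕ.* suc j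
    b = ∣ M ∣ ℕ.* ∣ M ∣
    c = ∣ t ∣ ℕ.* ∣ t ∣
    eq′ : a ℕ.* b ℕ.+ c ≡ b
    eq′ = +-injective (trans (cong (_+ (+ c)) (pos-* a b))
      (trans (cong₂ _+_ (cong₂ _*_ (sym k²≡) (sym (square M))) (sym (square t))) (trans eq (square M))))
    t²≡0 : c ≡ 0
    -- The product `suc j * suc j` unfolds to 1 + (j + j · suc j); cancelling b leaves a sum of
    -- naturals equal to 0.
    t²≡0 = ℕ.m+n≡0⇒n≡0 ((j ℕ.+ j ℕ.* suc j) ℕ.* b)
      (ℕ.+-cancelˡ-≡ b _ 0 (trans (sym (ℕ.+-assoc b _ c)) (trans eq′ (sym (ℕ.+-identityʳ b)))))

  -- With the sign absorbed into y, the product of the two norms is S² + T² = N⁴. As S = kN²,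
  -- `unit-circle` gives S = 0 or T = 0: the vectors (x₁, y₁) and (x₂, y) of equal length are
  -- perpendicular or parallel.
  same-or-swapped : ∀ N .{{_ : NonZero N}} s x₁ y₁ x₂ y₂ →
    x₁ * x₁ + y₁ * y₁ ≡ N * N → x₂ * x₂ + y₂ * y₂ ≡ N * N →
    N * N ∣ x₁ * x₂ + ⟦ s ⟧ * (y₁ * y₂) → x₁ * x₁ ≡ x₂ * x₂ ⊎ x₁ * x₁ ≡ y₂ * y₂
  same-or-swapped N s x₁ y₁ x₂ y₂ e₁ e₂ (divides k S≡) = Sum.[ inj₂ ∘ swapped , inj₁ ∘ same ]
      (unit-circle k T (N * N) eq)
    where
    y S T : ℤ
    y = ⟦ s ⟧ * y₂
    S = x₁ * x₂ + y₁ * y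
    T = x₁ * y - x₂ * y₁
    y² : y * y ≡ y₂ * y₂
    y² = trans (lemma ⟦ s ⟧ y₂) (trans (cong (_* (y₂ * y₂)) (⟦⟧²≡1 s)) (*-identityˡ (y₂ * y₂)))
      where
      lemma : ∀ s y → s * y * (s * y) ≡ s * s * (y * y)
      lemma = solve-∀
    S≡kN² : S ≡ k * (N * N)
    S≡kN² = trans (cong (_+_ (x₁ * x₂)) (lemma ⟦ s ⟧ y₁ y₂)) S≡
      where
      lemma : ∀ s y₁ y₂ → y₁ * (s * y₂) ≡ s * (y₁ * y₂)
      lemma = solve-∀
    e₂′ : x₂ * x₂ + y * y ≡ N * N
    e₂′ = trans (cong (_+_ (x₂ * x₂)) y²) e₂
    open ≡-Reasoning
    eq : k * k * (N * N * (N * N)) + T * T ≡ N * N * (N * N)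
    eq = begin
      k * k * (N * N * (N * N)) + T * T             ≡⟨ cong (_+ T * T) (lemma₁ k (N * N)) ⟩
      k * (N * N) * (k * (N * N)) + T * T           ≡⟨ cong (λ S → S * S + T * T) S≡kN² ⟨
      S * S + T * T                                 ≡⟨ lemma₂ x₁ y₁ x₂ y ⟩
      (x₁ * x₁ + y₁ * y₁) * (x₂ * x₂ + y * y)       ≡⟨ cong₂ _*_ e₁ e₂′ ⟩
      N * N * (N * N)                               ∎
      where
      lemma₁ : ∀ k M → k * k * (M * M) ≡ k * M * (k * M)
      lemma₁ = solve-∀
      lemma₂ : ∀ x₁ y₁ x₂ y → (x₁ * x₂ + y₁ * y) * (x₁ * x₂ + y₁ * y) + (x₁ * y - x₂ * y₁) *
          (x₁ * y - x₂ * y₁) ≡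
        (x₁ * x₁ + y₁ * y₁) * (x₂ * x₂ + y * y)
      lemma₂ = solve-∀
    cancel : ∀ a b → a * (N * N) ≡ b * (N * N) → a ≡ b
    cancel a b = *-cancelʳ-≡ a b (N * N) {{i*j≢0 N N}}
    swapped : k ≡ 0ℤ → x₁ * x₁ ≡ y₂ * y₂
    swapped refl = trans (cancel (x₁ * x₁) (y * y) (begin
      x₁ * x₁ * (N * N)                                             ≡⟨ cong (x₁ * x₁ *_) e₂′ ⟨
      x₁ * x₁ * (x₂ * x₂ + y * y)                                   ≡⟨ lemma x₁ y₁ x₂ y ⟩
      y * y * (x₁ * x₁ + y₁ * y₁) + (x₁ * x₂ - y₁ * y) * S
          ≡⟨ cong₂ (λ u v → y * y * u + (x₁ * x₂ - y₁ * y) * v) e₁ S≡kN² ⟩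
      y * y * (N * N) + (x₁ * x₂ - y₁ * y) * 0ℤ
          ≡⟨ cong (_+_ (y * y * (N * N))) (*-zeroʳ (x₁ * x₂ - y₁ * y)) ⟩
      y * y * (N * N) + 0ℤ                                          ≡⟨ +-identityʳ _ ⟩
      y * y * (N * N)                                               ∎)) y²
      where
      lemma : ∀ x₁ y₁ x₂ y → x₁ * x₁ * (x₂ * x₂ + y * y) ≡ y * y * (x₁ * x₁ + y₁ * y₁) + (x₁ * x₂ - y₁ * y)
          * (x₁ * x₂ + y₁ * y)
      lemma = solve-∀
    same : T ≡ 0ℤ → x₁ * x₁ ≡ x₂ * x₂
    same T≡0 = cancel (x₁ * x₁) (x₂ * x₂) (begin
      x₁ * x₁ * (N * N)                                             ≡⟨ cong (x₁ * x₁ *_) e₂′ ⟨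
      x₁ * x₁ * (x₂ * x₂ + y * y)                                   ≡⟨ lemma x₁ y₁ x₂ y ⟩
      x₂ * x₂ * (x₁ * x₁ + y₁ * y₁) + (x₁ * y + x₂ * y₁) * T
          ≡⟨ cong₂ (λ u v → x₂ * x₂ * u + (x₁ * y + x₂ * y₁) * v) e₁ T≡0 ⟩
      x₂ * x₂ * (N * N) + (x₁ * y + x₂ * y₁) * 0ℤ
          ≡⟨ cong (_+_ (x₂ * x₂ * (N * N))) (*-zeroʳ (x₁ * y + x₂ * y₁)) ⟩
      x₂ * x₂ * (N * N) + 0ℤ                                        ≡⟨ +-identityʳ _ ⟩
      x₂ * x₂ * (N * N)                                             ∎)
      where
      lemma : ∀ x₁ y₁ x₂ y → x₁ * x₁ * (x₂ * x₂ + y * y) ≡ x₂ * x₂ * (x₁ * x₁ + y₁ * y₁) +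
          (x₁ * y + x₂ * y₁) * (x₁ * y - x₂ * y₁)
      lemma = solve-∀

  -- If the signs for p and q disagree on the pairs 1, 2 and 1, 3, then both factors of the product
  -- change, and the signs for 2, 3 agree.
  two-of-three : ∀ s s′ t t′ → s ≡ s′ ⊎ t ≡ t′ ⊎ s Sign.* t ≡ s′ Sign.* t′
  two-of-three Sign.+ Sign.+ _ _ = inj₁ refl
  two-of-three Sign.- Sign.- _ _ = inj₁ refl
  two-of-three _ _ Sign.+ Sign.+ = inj₂ (inj₁ refl)
  two-of-three _ _ Sign.- Sign.- = inj₂ (inj₁ refl)
  two-of-three Sign.+ Sign.- Sign.+ Sign.- = inj₂ (inj₂ refl)
  two-of-three Sign.+ Sign.- Sign.- Sign.+ = inj₂ (inj₂ refl)
  two-of-three Sign.- Sign.+ Sign.+ Sign.- = inj₂ (inj₂ refl)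
  two-of-three Sign.- Sign.+ Sign.- Sign.+ = inj₂ (inj₂ refl)

-- Heron triangles as norm equations, and the triangles with p dividing x.

module Triangles where

  open import Data.Empty using (⊥; ⊥-elim)
  open import Data.Integer hiding (suc; pred)
  open import Data.Integer.Properties
  open import Data.Integer.Divisibility.Signed
  open _∣_ using (quotient; equality)
  open import Data.Integer.Tactic.RingSolver using (solve-∀)
  open import Data.Nat as ℕ using (ℕ; zero; suc)
  import Data.Nat.Properties as ℕ
  import Data.Nat.Divisibility as ℕ
  import Data.Nat.Tactic.RingSolver as ℕ
  open import Data.Nat.Primality using (Prime; euclidsLemma; prime⇒nonZero; prime[2])
  open import Data.Product using (_,_; ∃-syntax)
  import Data.Sign as Sign
  open import Data.Sum as Sum using (inj₁; inj₂)
  open import Function using (_∘_)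
  open import Relation.Binary.Definitions using (tri<; tri≈; tri>)
  open import Relation.Binary.PropositionalEquality
    using (_≡_; refl; sym; trans; cong; cong₂; subst; module ≡-Reasoning)
  open import Relation.Nullary using (¬_; contradiction)
  open Residues
  open Norms

  square-injective : ∀ m n → m ℕ.* m ≡ n ℕ.* n → m ≡ n
  square-injective m n eq with ℕ.<-cmp m n
  ... | tri< lt _ _ = contradiction eq (ℕ.<⇒≢ (ℕ.*-mono-< lt lt))
  ... | tri≈ _ m≡n _ = m≡n
  ... | tri> _ _ gt = contradiction (sym eq) (ℕ.<⇒≢ (ℕ.*-mono-< gt gt))

  -- 2pq·cos C, where C is the angle between the sides p and q.
  lawOfCosines : ℕ → ℕ → ℕ → ℤ
  lawOfCosines p q c = + p * + p + + q * + q - + c * + c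

  record Solution (p q c : ℕ) : Set where
    field
      p<q+c : p ℕ.< q ℕ.+ c
      q<p+c : q ℕ.< p ℕ.+ c
      c<p+q : c ℕ.< p ℕ.+ q
      2∣perimeter : 2 ℕ.∣ p ℕ.+ q ℕ.+ c
      x : ℤ
      2x≡ : + 2 * x ≡ lawOfCosines p q c
      A : ℕ
      0<A : 0 ℕ.< A

    y : ℤ
    y = + 2 * + A

    field
      norm : x * x + y * y ≡ (+ p * + q) * (+ p * + q)

    -- Parity later distinguishes y from x: for odd p and q the norm is odd, which rules out the
    -- swapped case of `same-or-swapped`.
    2∣y² : + 2 ∣ y * y
    2∣y² = ∣m⇒∣m*n y (∣m⇒∣m*n (+ A) ∣-refl)

  swap-sides : ∀ {p q c} → Solution p q c → Solution q p c
  swap-sides {p} {q} {c} s = record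
    { p<q+c = q<p+c ; q<p+c = p<q+c ; c<p+q = subst (c ℕ.<_) (ℕ.+-comm p q) c<p+q
    ; 2∣perimeter = subst (λ t → 2 ℕ.∣ t ℕ.+ c) (ℕ.+-comm p q) 2∣perimeter
    ; x = x ; 2x≡ = trans 2x≡ (cong (_- + c * + c) (+-comm (+ p * + p) (+ q * + q)))
    ; A = A ; 0<A = 0<A ; norm = trans norm (cong (λ t → t * t) (*-comm (+ p) (+ q))) }
    where open Solution s

  -- Heron's formula expands to X² + 16A² = 4(pq)² for X = p² + q² - c². Hence X is even and x = X/2
  -- is an integer. The square of the perimeter is X plus an even number, so the perimeter is even
  -- too.
  heron⇒solution : ∀ {p q c} → IsHeron p q c → Solution p q c
  heron⇒solution {p} {q} {c} ((_ , p<q+c , q<p+c , c<p+q) , A , 0<A , area) = record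
    { p<q+c = p<q+c ; q<p+c = q<p+c ; c<p+q = c<p+q
    ; 2∣perimeter = ∣⇒∣ᵤ (prime∣²⇒∣ prime[2] (P + Q + C) (subst (+ 2 ∣_) (lemma₂ P Q C)
        (∣m∣n⇒∣m+n 2∣X (∣m⇒∣m*n (C * C + P * Q + Q * C + P * C) ∣-refl))))
    ; x = x ; 2x≡ = trans (*-comm (+ 2) x) (sym X≡x2) ; A = A ; 0<A = 0<A
    ; norm = *-cancelˡ-≡ (+ 4) _ _ (begin
        + 4 * (x * x + + 2 * + A * (+ 2 * + A))          ≡⟨ lemma₃ x (+ A) ⟩
        x * + 2 * (x * + 2) + + 16 * (+ A * + A)         ≡⟨ cong (λ X → X * X + + 16 * (+ A * + A)) X≡x2 ⟨
        lawOfCosines p q c * lawOfCosines p q c + + 16 * (+ A * + A) ≡⟨ cong (_+ + 16 * (+ A * + A)) X²≡ ⟩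
        + 2 * (+ 2 * (P * Q * (P * Q)) - + 8 * (+ A * + A)) + + 16 * (+ A * + A) ≡⟨ lemma₄ P Q (+ A) ⟩
        + 4 * (P * Q * (P * Q))                          ∎) }
    where
    P Q C : ℤ
    P = + p
    Q = + q
    C = + c
    open ≡-Reasoning
    pos-∸ : ∀ {m n} → n ℕ.< m → + (m ℕ.∸ n) ≡ + m - + n
    pos-∸ {m} {n} n<m = sym (trans (m-n≡m⊖n m n) (⊖-≥ (ℕ.<⇒≤ n<m)))
    lemma₂ : ∀ P Q C → P * P + Q * Q - C * C + + 2 * (C * C + P * Q + Q * C + P * C) ≡ (P + Q + C) *
        (P + Q + C)
    lemma₂ = solve-∀
    lemma₃ : ∀ x A → + 4 * (x * x + + 2 * A * (+ 2 * A)) ≡ x * + 2 * (x * + 2) + + 16 * (A * A)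
    lemma₃ = solve-∀
    lemma₄ : ∀ P Q A → + 2 * (+ 2 * (P * Q * (P * Q)) - + 8 * (A * A)) + + 16 * (A * A) ≡ + 4 *
        (P * Q * (P * Q))
    lemma₄ = solve-∀
    lemma₅ : ∀ P Q C → (P * P + Q * Q - C * C) * (P * P + Q * Q - C * C) ≡
      + 4 * (P * Q * (P * Q)) - (P + Q + C) * (Q + C - P) * (P + C - Q) * (P + Q - C)
    lemma₅ = solve-∀
    lemma₆ : ∀ M A → + 4 * M - + 16 * (A * A) ≡ + 2 * (+ 2 * M - + 8 * (A * A))
    lemma₆ = solve-∀
    pos-area : + 16 * (+ A * + A) ≡ (P + Q + C) * (Q + C - P) * (P + C - Q) * (P + Q - C)
    pos-area = begin
      + 16 * (+ A * + A)                  ≡⟨ cong (+ 16 *_) (pos-* A A) ⟨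
      + 16 * + (A ℕ.* A)                  ≡⟨ pos-* 16 (A ℕ.* A) ⟨
      + (16 ℕ.* (A ℕ.* A))                ≡⟨ cong +_ area ⟩
      + (s ℕ.* u ℕ.* v ℕ.* w)             ≡⟨ pos-* (s ℕ.* u ℕ.* v) w ⟩
      + (s ℕ.* u ℕ.* v) * + w             ≡⟨ cong (_* + w) (pos-* (s ℕ.* u) v) ⟩
      + (s ℕ.* u) * + v * + w             ≡⟨ cong (λ t → t * + v * + w) (pos-* s u) ⟩
      + s * + u * + v * + w
          ≡⟨ cong₂ _*_ (cong₂ _*_ (cong (+ s *_) (pos-∸ p<q+c)) (pos-∸ q<p+c)) (pos-∸ c<p+q) ⟩
      (P + Q + C) * (Q + C - P) * (P + C - Q) * (P + Q - C) ∎
      where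
      s u v w : ℕ
      s = p ℕ.+ q ℕ.+ c
      u = q ℕ.+ c ℕ.∸ p
      v = p ℕ.+ c ℕ.∸ q
      w = p ℕ.+ q ℕ.∸ c
    X²≡ : lawOfCosines p q c * lawOfCosines p q c ≡ + 2 * (+ 2 * (P * Q * (P * Q)) - + 8 * (+ A * + A))
    X²≡ = trans (lemma₅ P Q C)
        (trans (cong (_-_ (+ 4 * (P * Q * (P * Q)))) (sym pos-area)) (lemma₆ (P * Q * (P * Q)) (+ A)))

    2∣X : + 2 ∣ lawOfCosines p q c
    2∣X = prime∣²⇒∣ prime[2] (lawOfCosines p q c)
      (subst (+ 2 ∣_) (sym X²≡) (∣m⇒∣m*n (+ 2 * (P * Q * (P * Q)) - + 8 * (+ A * + A)) ∣-refl))
    x : ℤ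
    x = quotient 2∣X
    X≡x2 : lawOfCosines p q c ≡ x * + 2
    X≡x2 = equality 2∣X

  module _ {p q c : ℕ} (s : Solution p q c) where
    open Solution s

    p%4≡3⇒p∣x : Prime p → p ℕ.% 4 ≡ 3 → + p ∣ x
    p%4≡3⇒p∣x pp p%4≡3 = ∣ᵤ⇒∣
        (p∣x²+y²⇒p∣y (∣ y ∣) ∣ x ∣ pp p%4≡3 (subst (p ℕ.∣_) eq (ℕ.∣m⇒∣m*n (p ℕ.* q) (ℕ.m∣m*n q))))
      where
      eq : p ℕ.* q ℕ.* (p ℕ.* q) ≡ ∣ y ∣ ℕ.* ∣ y ∣ ℕ.+ ∣ x ∣ ℕ.* ∣ x ∣
      eq = +-injective (trans (pos-* (p ℕ.* q) (p ℕ.* q))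
          (trans (cong (λ t → t * t) (pos-* p q)) (trans (sym norm)
        (trans (+-comm (x * x) (y * y)) (cong₂ _+_ (square y) (square x))))))

    -- Since 2x = p² + q² - c², p divides (c - q)(c + q). If p divides c - q, then ∣c - q∣ < p
    -- forces c = q, and the perimeter p + 2c is odd. So p divides c + q, hence the perimeter; the
    -- latter is even and p is odd, which makes the quotient even.
    semiperimeter-multiple : Prime p → ¬ (2 ℕ.∣ p) → + p ∣ x → ∃[ j ] p ℕ.+ q ℕ.+ c ≡ 2 ℕ.* (j ℕ.* p)
    semiperimeter-multiple pp odd p∣x = Sum.[ ⊥-elim ∘ case₁ ∘ ∣⇒∣ᵤ , case₂ ∘ ∣⇒∣ᵤ ]
        (prime∣*⇒∣⊎∣ pp (+ c - + q) (+ c + + q) p∣[c-q][c+q])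
      where
      instance
        p≢0 : ℕ.NonZero p
        p≢0 = prime⇒nonZero pp
      lemma : ∀ P Q C → P * P - (P * P + Q * Q - C * C) ≡ (C - Q) * (C + Q)
      lemma = solve-∀
      p∣[c-q][c+q] : + p ∣ (+ c - + q) * (+ c + + q)
      p∣[c-q][c+q] = subst (+ p ∣_) (trans (cong (_-_ (+ p * + p)) 2x≡) (lemma (+ p) (+ q) (+ c)))
        (∣m∣n⇒∣m-n (∣m⇒∣m*n (+ p) ∣-refl) (∣n⇒∣m*n (+ 2) p∣x))
      multiple<⇒≡0 : ∀ {m} → p ℕ.∣ m → m ℕ.< p → m ≡ 0
      multiple<⇒≡0 {zero} _ _ = refl
      multiple<⇒≡0 {suc m} p∣m m<p = contradiction p∣m (ℕ.>⇒∤ m<p)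
      c≡q⇒⊥ : c ≡ q → ⊥
      c≡q⇒⊥ refl = odd (ℕ.∣m+n∣m⇒∣n (subst (2 ℕ.∣_) (lemma₁ p c) 2∣perimeter) (ℕ.m∣m*n c))
        where
        lemma₁ : ∀ p c → p ℕ.+ c ℕ.+ c ≡ 2 ℕ.* c ℕ.+ p
        lemma₁ = ℕ.solve-∀
      case₁ : p ℕ.∣ ∣ + c - + q ∣ → ⊥
      case₁ p∣ with subst (λ t → p ℕ.∣ ∣ t ∣) (m-n≡m⊖n c q) p∣ | ℕ.≤-total c q
      ... | p∣′ | inj₁ c≤q = c≡q⇒⊥
            (ℕ.≤-antisym c≤q (ℕ.m∸n≡0⇒m≤n (multiple<⇒≡0 (subst (p ℕ.∣_) (∣⊖∣-≤ c≤q) p∣′)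
              (ℕ.m<n+o⇒m∸n<o q c (subst (q ℕ.<_) (ℕ.+-comm p c) q<p+c)))))
      ... | p∣′ | inj₂ q≤c = c≡q⇒⊥
            (ℕ.≤-antisym (ℕ.m∸n≡0⇒m≤n (multiple<⇒≡0 (subst (p ℕ.∣_) (trans (∣m⊖n∣≡∣n⊖m∣ c q) (∣⊖∣-≤ q≤c)) p∣′)
              (ℕ.m<n+o⇒m∸n<o c q (subst (c ℕ.<_) (ℕ.+-comm p q) c<p+q)))) q≤c)
      case₂ : p ℕ.∣ c ℕ.+ q → ∃[ j ] p ℕ.+ q ℕ.+ c ≡ 2 ℕ.* (j ℕ.* p)
      case₂ p∣c+q
        with ℕ.divides k eq ← subst (p ℕ.∣_) (trans (cong (p ℕ.+_) (ℕ.+-comm c q)) (sym (ℕ.+-assoc p q c)))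
            (ℕ.∣m∣n⇒∣m+n (ℕ.∣-refl {p}) p∣c+q)
        with euclidsLemma k p prime[2] (subst (2 ℕ.∣_) eq 2∣perimeter)
      ... | inj₁ (ℕ.divides j refl) = j , trans eq (lemma₁ j p)
        where
        lemma₁ : ∀ j p → j ℕ.* 2 ℕ.* p ≡ 2 ℕ.* (j ℕ.* p)
        lemma₁ = ℕ.solve-∀
      ... | inj₂ 2∣p = contradiction 2∣p odd

    module _ (j : ℕ) (2jp≡ : p ℕ.+ q ℕ.+ c ≡ 2 ℕ.* (j ℕ.* p)) where
      open ℕ.≤-Reasoning

      -- In terms of the semiperimeter s = jp, the triangle inequalities say that each side is less
      -- than s. This is the one for q; those for c and p follow.
      q<jp : q ℕ.< j ℕ.* p
      q<jp = ℕ.*-cancelˡ-< 2 q (j ℕ.* p) (begin-strict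
        2 ℕ.* q             ≡⟨ lemma q ⟩
        q ℕ.+ q             <⟨ ℕ.+-monoˡ-< q q<p+c ⟩
        p ℕ.+ c ℕ.+ q       ≡⟨ lemma₁ p c q ⟩
        p ℕ.+ q ℕ.+ c       ≡⟨ 2jp≡ ⟩
        2 ℕ.* (j ℕ.* p)     ∎)
        where
        lemma : ∀ q → 2 ℕ.* q ≡ q ℕ.+ q
        lemma = ℕ.solve-∀
        lemma₁ : ∀ p c q → p ℕ.+ c ℕ.+ q ≡ p ℕ.+ q ℕ.+ c
        lemma₁ = ℕ.solve-∀

      jp<p+q : j ℕ.* p ℕ.< p ℕ.+ q
      jp<p+q = ℕ.*-cancelˡ-< 2 (j ℕ.* p) (p ℕ.+ q) (begin-strict
        2 ℕ.* (j ℕ.* p)           ≡⟨ 2jp≡ ⟨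
        p ℕ.+ q ℕ.+ c             <⟨ ℕ.+-monoʳ-< (p ℕ.+ q) c<p+q ⟩
        p ℕ.+ q ℕ.+ (p ℕ.+ q)     ≡⟨ lemma (p ℕ.+ q) ⟩
        2 ℕ.* (p ℕ.+ q)           ∎)
        where
        lemma : ∀ q → q ℕ.+ q ≡ 2 ℕ.* q
        lemma = ℕ.solve-∀

      1<j : 1 ℕ.< j
      1<j = ℕ.*-cancelʳ-< p 1 j (ℕ.*-cancelˡ-< 2 (1 ℕ.* p) (j ℕ.* p) (begin-strict
        2 ℕ.* (1 ℕ.* p)     ≡⟨ lemma p ⟩
        p ℕ.+ p             <⟨ ℕ.+-monoʳ-< p p<q+c ⟩
        p ℕ.+ (q ℕ.+ c)     ≡⟨ ℕ.+-assoc p q c ⟨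
        p ℕ.+ q ℕ.+ c       ≡⟨ 2jp≡ ⟩
        2 ℕ.* (j ℕ.* p)     ∎))
        where
        lemma : ∀ q → 2 ℕ.* (1 ℕ.* q) ≡ q ℕ.+ q
        lemma = ℕ.solve-∀

    -- From j ≥ 2 and jp < p + q it follows that 2p < p + q.
    p∣x⇒p<q : Prime p → ¬ (2 ℕ.∣ p) → + p ∣ x → p ℕ.< q
    p∣x⇒p<q pp odd p∣x = let j , eq = semiperimeter-multiple pp odd p∣x in ℕ.+-cancelˡ-< p p q (begin-strict
      p ℕ.+ p       ≡⟨ cong (p ℕ.+_) (ℕ.+-identityʳ p) ⟨
      2 ℕ.* p       ≤⟨ ℕ.*-monoˡ-≤ p (1<j j eq) ⟩
      j ℕ.* p       <⟨ jp<p+q j eq ⟩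
      p ℕ.+ q       ∎)
      where open ℕ.≤-Reasoning

  multiples-≤ : ∀ {p q j j′} → j ℕ.* p ℕ.< p ℕ.+ q → q ℕ.< j′ ℕ.* p → j ℕ.≤ j′
  multiples-≤ {p} {q} {j} {j′} lt lt′ = ℕ.≤-pred
      (ℕ.*-cancelʳ-< p j (suc j′) (ℕ.<-trans lt (ℕ.+-monoʳ-< p lt′)))

  -- The semiperimeter is the only multiple of p strictly between q and p + q, so p and q determine
  -- the perimeter.
  p∣x⇒c-unique : ∀ {p q c c′} → Prime p → ¬ (2 ℕ.∣ p) → (s : Solution p q c) (s′ : Solution p q c′) →
    + p ∣ Solution.x s → + p ∣ Solution.x s′ → c ≡ c′
  p∣x⇒c-unique {p} {q} {c} {c′} pp odd s s′ p∣x p∣x′ =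
    let j  , eq  = semiperimeter-multiple s pp odd p∣x
        j′ , eq′ = semiperimeter-multiple s′ pp odd p∣x′
        j≡j′ = ℕ.≤-antisym (multiples-≤ {p} {q} {j} {j′} (jp<p+q s j eq) (q<jp s′ j′ eq′))
                           (multiples-≤ {p} {q} {j′} {j} (jp<p+q s′ j′ eq′) (q<jp s j eq))
    in ℕ.+-cancelˡ-≡ (p ℕ.+ q) c c′ (trans eq (trans (cong (λ i → 2 ℕ.* (i ℕ.* p)) j≡j′) (sym eq′)))

-- The upper bounds of (1), (3) and (4).

module UnequalPrimes where

  open import Data.Empty using (⊥; ⊥-elim)
  open import Data.Integer hiding (suc; pred)
  open import Data.Integer.Properties
  open import Data.Integer.Divisibility.Signed
  open import Data.Integer.Tactic.RingSolver using (solve-∀)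
  open import Data.List using (List; []; _∷_; filter; length)
  open import Data.List.Membership.Propositional using (_∈_)
  open import Data.List.Membership.Propositional.Properties using (∈-filter⁻)
  open import Data.List.Relation.Unary.Any using (here)
  open import Data.List.Relation.Unary.Unique.Propositional using (Unique)
  import Data.List.Relation.Unary.Unique.Propositional.Properties as Unique
  open import Data.Nat as ℕ using (ℕ)
  import Data.Nat.Properties as ℕ
  import Data.Nat.Divisibility as ℕ
  open import Data.Nat.Primality using (Prime; prime⇒nonZero; prime[2])
  open import Data.Product using (_×_; _,_; ∃-syntax)
  open import Data.Sign as Sign using (Sign)
  import Data.Sign.Properties as Sign
  open import Data.Sum as Sum using (_⊎_; inj₁; inj₂)
  open import Function using (_∘_; Equivalence)
  open import Relation.Binary.PropositionalEquality
    using (_≡_; _≢_; refl; sym; trans; cong; subst; module ≡-Reasoning)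
  open import Relation.Nullary using (¬_; contradiction)
  open import Relation.Nullary.Decidable using (_⊎-dec_; ¬?)
  open import Relation.Unary using (Decidable)
  open Counting
  open Residues
  open Norms
  open Triangles

  ∈⇒solution : ∀ p q {c} → c ∈ thirdSides p q → Solution p q c
  ∈⇒solution p q {c} c∈ = heron⇒solution (Equivalence.to (thirdSides-correct p q c) c∈)

  length≡0 : ∀ {A : Set} {xs : List A} → (∀ {x} → x ∈ xs → ⊥) → length xs ≡ 0
  length≡0 {xs = []} _ = refl
  length≡0 {xs = _ ∷ _} none = ⊥-elim (none (here refl))

  -- Both primes divide x, so each would be smaller than the other.
  H≡0 : ∀ {p q} → Prime p → Prime q → p ℕ.% 4 ≡ 3 → q ℕ.% 4 ≡ 3 → H p q ≡ 0
  H≡0 {p} {q} pp pq p≡3 q≡3 = length≡0 λ c∈ → let s = ∈⇒solution p q c∈ ; s′ = swap-sides s in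
    ℕ.<-asym (p∣x⇒p<q s pp (odd-residue⇒odd {p} 2∤3 p≡3) (p%4≡3⇒p∣x s pp p≡3))
             (p∣x⇒p<q s′ pq (odd-residue⇒odd {q} 2∤3 q≡3) (p%4≡3⇒p∣x s′ pq q≡3))

  -- A prime ≡ 3 mod 4 divides x for every triangle, and then c is unique. The argument gives the
  -- bound 1, which is weakened to 2.
  H≤2 : ∀ {p q} → Prime p → Prime q → (p ℕ.% 4 ≡ 3) ⊎ (q ℕ.% 4 ≡ 3) → H p q ℕ.≤ 2
  H≤2 {p} {q} pp pq p≡3⊎q≡3 = ℕ.m≤n⇒m≤1+n (length≤1 (thirdSides-unique p q) (unique p≡3⊎q≡3))
    where
    unique : (p ℕ.% 4 ≡ 3) ⊎ (q ℕ.% 4 ≡ 3) → ∀ {c c′} → c ∈ thirdSides p q → c′ ∈ thirdSides p q → c ≡ c′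
    unique (inj₁ p≡3) c∈ c′∈ = let s = ∈⇒solution p q c∈ ; s′ = ∈⇒solution p q c′∈ in
      p∣x⇒c-unique pp (odd-residue⇒odd {p} 2∤3 p≡3) s s′ (p%4≡3⇒p∣x s pp p≡3) (p%4≡3⇒p∣x s′ pp p≡3)
    unique (inj₂ q≡3) c∈ c′∈ = let s = swap-sides (∈⇒solution p q c∈) ; s′ = swap-sides (∈⇒solution p q c′∈) in
      p∣x⇒c-unique pq (odd-residue⇒odd {q} 2∤3 q≡3) s s′ (p%4≡3⇒p∣x s pq q≡3) (p%4≡3⇒p∣x s′ pq q≡3)

  module DistinctOddPrimes {p q : ℕ} (pp : Prime p) (pq : Prime q) (p≢q : p ≢ q)
    (p-odd : ¬ (2 ℕ.∣ p)) (q-odd : ¬ (2 ℕ.∣ q)) where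
    open Solution

    -- Unlike x, which belongs to a `Solution`, X = 2x is defined for every c, so the list of third
    -- sides can be filtered by decidable conditions on it.
    X : ℕ → ℤ
    X = lawOfCosines p q

    -- The triangles whose Gaussian integer x + iy is divisible by p or q.
    Imprimitive : ℕ → Set
    Imprimitive c = (+ p ∣ X c) ⊎ (+ q ∣ X c)

    imprimitive? : Decidable Imprimitive
    imprimitive? c = (+ p ∣? X c) ⊎-dec (+ q ∣? X c)

    ∣X⇒∣x : ∀ {r c} → Prime r → ¬ (2 ℕ.∣ r) → (s : Solution p q c) → + r ∣ X c → + r ∣ x s
    ∣X⇒∣x {r} pr r-odd s r∣X with prime∣*⇒∣⊎∣ pr (+ 2) (x s) (subst (+ r ∣_) (sym (2x≡ s)) r∣X)
    ... | inj₂ r∣x = r∣x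
    ... | inj₁ r∣2 = contradiction (∣⇒∣ᵤ r∣2) (p∤q pr prime[2] λ { refl → r-odd ℕ.∣-refl })

    ∣x⇒∣X : ∀ {r c} (s : Solution p q c) → + r ∣ x s → + r ∣ X c
    ∣x⇒∣X {r} s r∣x = subst (+ r ∣_) (2x≡ s) (∣n⇒∣m*n (+ 2) r∣x)

    -- If p divides one value and q the other, then p < q and q < p. If the same prime divides both,
    -- `p∣x⇒c-unique` applies.
    imprimitive-unique : ∀ {c c′} → Solution p q c → Solution p q c′ → Imprimitive c → Imprimitive c′ → c ≡ c′
    imprimitive-unique s s′ (inj₁ p∣X) (inj₁ p∣X′) =
      p∣x⇒c-unique pp p-odd s s′ (∣X⇒∣x pp p-odd s p∣X) (∣X⇒∣x pp p-odd s′ p∣X′)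
    imprimitive-unique s s′ (inj₂ q∣X) (inj₂ q∣X′) =
      p∣x⇒c-unique pq q-odd (swap-sides s) (swap-sides s′) (∣X⇒∣x pq q-odd s q∣X) (∣X⇒∣x pq q-odd s′ q∣X′)
    imprimitive-unique s s′ (inj₁ p∣X) (inj₂ q∣X′) = contradiction
      (p∣x⇒p<q s pp p-odd (∣X⇒∣x pp p-odd s p∣X))
      (ℕ.<-asym (p∣x⇒p<q (swap-sides s′) pq q-odd (∣X⇒∣x pq q-odd s′ q∣X′)))
    imprimitive-unique s s′ (inj₂ q∣X) (inj₁ p∣X′) = sym (imprimitive-unique s′ s (inj₁ p∣X′) (inj₂ q∣X))

    N : ℤ
    N = + p * + q

    instance
      N≢0 : NonZero N
      N≢0 = i*j≢0 (+ p) (+ q) {{prime⇒nonZero pp}} {{prime⇒nonZero pq}}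

    N²-odd : ¬ (+ 2 ∣ N * N)
    N²-odd 2∣N² = Sum.[ p-odd ∘ ∣⇒∣ᵤ , q-odd ∘ ∣⇒∣ᵤ ]
        (prime∣*⇒∣⊎∣ prime[2] (+ p) (+ q) (prime∣²⇒∣ prime[2] N 2∣N²))

    p²∣norm : ∀ {c} (s : Solution p q c) → + p * + p ∣ x s * x s + y s * y s
    p²∣norm s = divides (+ q * + q) (trans (norm s) (lemma (+ p) (+ q)))
      where
      lemma : ∀ P Q → P * Q * (P * Q) ≡ Q * Q * (P * P)
      lemma = solve-∀

    q²∣norm : ∀ {c} (s : Solution p q c) → + q * + q ∣ x s * x s + y s * y s
    q²∣norm s = divides (+ p * + p) (trans (norm s) (lemma (+ p) (+ q)))
      where
      lemma : ∀ P Q → P * Q * (P * Q) ≡ P * P * (Q * Q)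
      lemma = solve-∀

    RelativeSign : ∀ {c c′} → ℕ → Sign → Solution p q c → Solution p q c′ → Set
    RelativeSign r σ s s′ = + r * + r ∣ x s * x s′ + ⟦ σ ⟧ * (y s * y s′)

    -- With a common sign, p² and q² divide the same expression, hence so does N², and
    -- `same-or-swapped` applies. The swapped case x² = y′² would make N² = y′² + y² even.
    same-signs⇒x²≡ : ∀ {c c′} σ τ (s : Solution p q c) (s′ : Solution p q c′) → σ ≡ τ →
      RelativeSign p σ s s′ → RelativeSign q τ s s′ → x s * x s ≡ x s′ * x s′
    same-signs⇒x²≡ σ _ s s′ refl p² q² = Sum.[ (λ x²≡x′² → x²≡x′²) ,
        (λ x²≡y′² → contradiction (swapped x²≡y′²) N²-odd) ]
      (same-or-swapped N σ (x s) (y s) (x s′) (y s′) (norm s) (norm s′)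
        (p²∣k∧q²∣k⇒p²q²∣k pp pq p≢q (x s * x s′ + ⟦ σ ⟧ * (y s * y s′)) p² q²))
      where
      swapped : x s * x s ≡ y s′ * y s′ → + 2 ∣ N * N
      swapped x²≡y′² = subst (+ 2 ∣_) (trans (cong (_+ y s * y s) (sym x²≡y′²)) (norm s))
          (∣m∣n⇒∣m+n (2∣y² s′) (2∣y² s))

    -- Conjugating the p-part and the q-part of x + iy generates all primitive
    -- solutions, so up to sign x takes two values.
    three-primitive : ∀ {c₁ c₂ c₃} (s₁ : Solution p q c₁) (s₂ : Solution p q c₂) (s₃ : Solution p q c₃) →
      ¬ Imprimitive c₁ → ¬ Imprimitive c₂ → ¬ Imprimitive c₃ →
      x s₁ * x s₁ ≡ x s₂ * x s₂ ⊎ x s₁ * x s₁ ≡ x s₃ * x s₃ ⊎ x s₂ * x s₂ ≡ x s₃ * x s₃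
    three-primitive s₁ s₂ s₃ n₁ n₂ n₃ = conclude (sign-p s₁ s₂ n₁ n₂) (sign-q s₁ s₂ n₁ n₂)
        (sign-p s₁ s₃ n₁ n₃) (sign-q s₁ s₃ n₁ n₃)
      where
      sign-p : ∀ {c c′} (s : Solution p q c) (s′ : Solution p q c′) → ¬ Imprimitive c → ¬ Imprimitive c′ →
          ∃[ σ ] RelativeSign p σ s s′
      sign-p s s′ n n′ = relative-sign pp p-odd (x s) (y s) (x s′) (y s′) (n ∘ inj₁ ∘ ∣x⇒∣X s)
          (n′ ∘ inj₁ ∘ ∣x⇒∣X s′) (p²∣norm s) (p²∣norm s′)
      sign-q : ∀ {c c′} (s : Solution p q c) (s′ : Solution p q c′) → ¬ Imprimitive c → ¬ Imprimitive c′ →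
          ∃[ σ ] RelativeSign q σ s s′
      sign-q s s′ n n′ = relative-sign pq q-odd (x s) (y s) (x s′) (y s′) (n ∘ inj₂ ∘ ∣x⇒∣X s)
          (n′ ∘ inj₂ ∘ ∣x⇒∣X s′) (q²∣norm s) (q²∣norm s′)
      conclude : ∃[ σ ] RelativeSign p σ s₁ s₂ → ∃[ σ′ ] RelativeSign q σ′ s₁ s₂ →
        ∃[ τ ] RelativeSign p τ s₁ s₃ → ∃[ τ′ ] RelativeSign q τ′ s₁ s₃ →
        x s₁ * x s₁ ≡ x s₂ * x s₂ ⊎ x s₁ * x s₁ ≡ x s₃ * x s₃ ⊎ x s₂ * x s₂ ≡ x s₃ * x s₃
      conclude (σ , p₂) (σ′ , q₂) (τ , p₃) (τ′ , q₃) = Sum.map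
        (λ σ≡σ′ → same-signs⇒x²≡ σ σ′ s₁ s₂ σ≡σ′ p₂ q₂)
        (Sum.map (λ τ≡τ′ → same-signs⇒x²≡ τ τ′ s₁ s₃ τ≡τ′ p₃ q₃)
          (λ στ≡ → same-signs⇒x²≡ (σ Sign.* τ) (σ′ Sign.* τ′) s₂ s₃ στ≡
            (relative-sign-* pp σ τ (x s₁) (y s₁) (x s₂) (y s₂) (x s₃) (y s₃) (n₁ ∘ inj₁ ∘ ∣x⇒∣X s₁)
                (p²∣norm s₁) p₂ p₃)
            (relative-sign-* pq σ′ τ′ (x s₁) (y s₁) (x s₂) (y s₂) (x s₃) (y s₃) (n₁ ∘ inj₂ ∘ ∣x⇒∣X s₁)
                (q²∣norm s₁) q₂ q₃)))
        (two-of-three σ σ′ τ τ′)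

    -- Equal squares of x give equal ∣X∣. With equal signs the values of X agree, and c² = p² + q² -
    -- X.
    x²≡⇒c≡ : ∀ {c c′} (s : Solution p q c) (s′ : Solution p q c′) → sign (X c) ≡ sign (X c′) →
      x s * x s ≡ x s′ * x s′ → c ≡ c′
    x²≡⇒c≡ {c} {c′} s s′ signs x²≡x′² = square-injective c c′ (+-injective (begin
      + (c ℕ.* c)                          ≡⟨ c²≡ c ⟩
      + p * + p + + q * + q - X c
          ≡⟨ cong (_-_ (+ p * + p + + q * + q)) (◃-cong signs (square-injective ∣ X c ∣ ∣ X c′ ∣ X²≡)) ⟩
      + p * + p + + q * + q - X c′         ≡⟨ c²≡ c′ ⟨
      + (c′ ℕ.* c′)                        ∎))
      where
      open ≡-Reasoning
      lemma : ∀ M C → C ≡ M - (M - C)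
      lemma = solve-∀
      c²≡ : ∀ c → + (c ℕ.* c) ≡ + p * + p + + q * + q - X c
      c²≡ c = trans (pos-* c c) (lemma (+ p * + p + + q * + q) (+ c * + c))
      lemma₁ : ∀ x → + 2 * x * (+ 2 * x) ≡ + 4 * (x * x)
      lemma₁ = solve-∀
      X² : ∀ {c} (s : Solution p q c) → + (∣ X c ∣ ℕ.* ∣ X c ∣) ≡ + 4 * (x s * x s)
      X² {c} s = trans (sym (square (X c))) (trans (sym (cong (λ t → t * t) (2x≡ s))) (lemma₁ (x s)))
      X²≡ : ∣ X c ∣ ℕ.* ∣ X c ∣ ≡ ∣ X c′ ∣ ℕ.* ∣ X c′ ∣
      X²≡ = +-injective (trans (X² s) (trans (cong (+ 4 *_) x²≡x′²) (sym (X² s′))))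

    -- Zero has sign `Sign.+`, so a right angle opposite c would count as acute.
    Acute : ℕ → Set
    Acute c = sign (X c) ≡ Sign.+

    acute? : Decidable Acute
    acute? c = sign (X c) Sign.≟ Sign.+

    obtuse⇒sign≡ : ∀ {c c′} → ¬ Acute c → ¬ Acute c′ → sign (X c) ≡ sign (X c′)
    obtuse⇒sign≡ {c} {c′} = not-+ (sign (X c)) (sign (X c′))
      where
      not-+ : ∀ σ τ → σ ≢ Sign.+ → τ ≢ Sign.+ → σ ≡ τ
      not-+ Sign.+ _ ≢+ _ = contradiction refl ≢+
      not-+ Sign.- Sign.- _ _ = refl
      not-+ Sign.- Sign.+ _ ≢+ = contradiction refl ≢+

    Primitive : ℕ → Set
    Primitive c = Solution p q c × ¬ Imprimitive c

    -- By `three-primitive` two of the three share x², and the common sign then identifies their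
    -- third sides.
    no-three : ∀ {c₁ c₂ c₃} → Primitive c₁ → Primitive c₂ → Primitive c₃ →
      sign (X c₁) ≡ sign (X c₂) → sign (X c₁) ≡ sign (X c₃) → c₁ ≢ c₂ → c₁ ≢ c₃ → c₂ ≢ c₃ → ⊥
    no-three (s₁ , n₁) (s₂ , n₂) (s₃ , n₃) e₁₂ e₁₃ c₁≢c₂ c₁≢c₃ c₂≢c₃ = Sum.[
      (λ e → c₁≢c₂ (x²≡⇒c≡ s₁ s₂ e₁₂ e)) , Sum.[
      (λ e → c₁≢c₃ (x²≡⇒c≡ s₁ s₃ e₁₃ e)) ,
      (λ e → c₂≢c₃ (x²≡⇒c≡ s₂ s₃ (trans (sym e₁₂) e₁₃) e)) ] ] (three-primitive s₁ s₂ s₃ n₁ n₂ n₃)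

    primitives : List ℕ
    primitives = filter (¬? ∘ imprimitive?) (thirdSides p q)

    primitives-unique : Unique primitives
    primitives-unique = Unique.filter⁺ (¬? ∘ imprimitive?) (thirdSides-unique p q)

    ∈-primitives⁻ : ∀ {c} → c ∈ primitives → Primitive c
    ∈-primitives⁻ c∈ with c∈sides , n ← ∈-filter⁻ (¬? ∘ imprimitive?) {xs = thirdSides p q} c∈ =
      ∈⇒solution p q c∈sides , n

    #imprimitive≤1 : length (filter imprimitive? (thirdSides p q)) ℕ.≤ 1
    #imprimitive≤1 = length≤1 (Unique.filter⁺ imprimitive? (thirdSides-unique p q)) λ c∈ c′∈ →
      let c∈sides , i = ∈-filter⁻ imprimitive? {xs = thirdSides p q} c∈
          c′∈sides , i′ = ∈-filter⁻ imprimitive? {xs = thirdSides p q} c′∈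
      in imprimitive-unique (∈⇒solution p q c∈sides) (∈⇒solution p q c′∈sides) i i′

    #acute≤2 : length (filter acute? primitives) ℕ.≤ 2
    #acute≤2 = length≤2 (Unique.filter⁺ acute? primitives-unique) λ c₁∈ c₂∈ c₃∈ →
      let c₁∈P , a₁ = ∈-filter⁻ acute? {xs = primitives} c₁∈
          c₂∈P , a₂ = ∈-filter⁻ acute? {xs = primitives} c₂∈
          c₃∈P , a₃ = ∈-filter⁻ acute? {xs = primitives} c₃∈
      in no-three (∈-primitives⁻ c₁∈P) (∈-primitives⁻ c₂∈P) (∈-primitives⁻ c₃∈P) (trans a₁ (sym a₂))
          (trans a₁ (sym a₃))

    #obtuse≤2 : length (filter (¬? ∘ acute?) primitives) ℕ.≤ 2
    #obtuse≤2 = length≤2 (Unique.filter⁺ (¬? ∘ acute?) primitives-unique) λ {c₁} {c₂} {c₃} c₁∈ c₂∈ c₃∈ →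
      let c₁∈P , a₁ = ∈-filter⁻ (¬? ∘ acute?) {xs = primitives} c₁∈
          c₂∈P , a₂ = ∈-filter⁻ (¬? ∘ acute?) {xs = primitives} c₂∈
          c₃∈P , a₃ = ∈-filter⁻ (¬? ∘ acute?) {xs = primitives} c₃∈
      in no-three (∈-primitives⁻ c₁∈P) (∈-primitives⁻ c₂∈P) (∈-primitives⁻ c₃∈P)
          (obtuse⇒sign≡ {c₁} {c₂} a₁ a₂) (obtuse⇒sign≡ {c₁} {c₃} a₁ a₃)

    -- The bound is 1 + (2 + 2): imprimitive, primitive acute and primitive obtuse triangles.
    H≤5 : H p q ℕ.≤ 5
    H≤5 = length-split-≤ imprimitive? acute? (thirdSides p q) #imprimitive≤1 #acute≤2 #obtuse≤2

-- Isosceles triangles as doubled right triangles: the exact count of (2).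

module EqualPrimes where

  open import Data.List using ([]; _∷_)
  open import Data.List.Membership.Propositional using (_∈_)
  open import Data.List.Relation.Unary.All using ([]; _∷_)
  open import Data.List.Relation.Unary.AllPairs using ([]; _∷_)
  open import Data.List.Relation.Unary.Any using (here; there)
  open import Data.Nat
  open import Data.Nat.DivMod using (m≡m%n+[m/n]*n)
  open import Data.Nat.Properties
  open import Data.Nat.Divisibility
  open import Data.Nat.Tactic.RingSolver using (solve-∀)
  open import Data.Integer as ℤ using (ℤ)
  import Data.Integer.Properties as ℤ
  open import Algebra.Bundles using (AbelianGroup)
  open import Algebra.Properties.Group (AbelianGroup.group ℤ.+-0-abelianGroup) using (∙-cancelˡ)
  import Data.Integer.Divisibility.Signed as ℤ
  import Data.Integer.Tactic.RingSolver as ℤ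
  open import Data.Nat.Primality using (Prime; euclidsLemma; prime⇒nonZero; prime[2])
  open import Data.Product using (_×_; _,_; ∃-syntax; proj₁; proj₂)
  open import Data.Sum as Sum using (_⊎_)
  open import Function using (_∘_; Equivalence)
  open import Relation.Binary.PropositionalEquality
    using (_≡_; _≢_; refl; sym; trans; cong; cong₂; subst; module ≡-Reasoning)
  open import Relation.Binary.Definitions using (tri<; tri≈; tri>)
  open import Relation.Nullary using (¬_; contradiction)
  open Counting
  open Residues
  open Windmills
  open Norms
  open Triangles

  -- One half of the isosceles triangle with sides p, p, 2d, cut along its altitude h.
  Legs : ℕ → ℕ → ℕ → Set
  Legs p d h = 0 < d × 0 < h × d * d + h * h ≡ p * p

  legs-sym : ∀ {p d h} → Legs p d h → Legs p h d
  legs-sym {p} {d} {h} (0<d , 0<h , e) = 0<h , 0<d , trans (+-comm (h * h) (d * d)) e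

  leg< : ∀ {p d h} → Legs p d h → d < p
  leg< {p} {d} {h} (_ , 0<h , e) = ≰⇒> λ p≤d →
    <⇒≱ (<-≤-trans (m<m+n (d * d) (*-mono-≤ 0<h 0<h)) (≤-reflexive e)) (*-mono-≤ p≤d p≤d)

  -- For p = a + b with a = x² and b = 4y², the identity (a - b)² + 4ab = (a + b)² gives the legs ∣a
  -- - b∣ and 4xy. If a = b, then p would be even.
  legs-exist : ∀ {p} → Prime p → p % 4 ≡ 1 → ∃[ d ] ∃[ h ] Legs p d h
  legs-exist {p} pp p%4≡1 = from-squares (Windmill.two-squares p (p / 4) pp
      (trans (m≡m%n+[m/n]*n p 4) (cong₂ _+_ p%4≡1 (*-comm (p / 4) 4))))
    where
    from-squares : ∃[ x ] ∃[ y ] (0 < x × 0 < y × x * x + 4 * (y * y) ≡ p) → ∃[ d ] ∃[ h ] Legs p d h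
    from-squares (x , y , 0<x , 0<y , refl) with <-cmp (x * x) (4 * (y * y))
    ... | tri< lt _ _ with e , 0<e , eq ← m<n⇒∃ lt = e , 4 * (x * y) , 0<e , *-mono-≤ (s≤s (z≤n {3}))
          (*-mono-≤ 0<x 0<y)
      , trans (cong (_+_ (e * e)) (lemma₀ x y)) (trans (cong (λ b → e * e + 4 * (x * x * b)) eq)
          (trans (lemma (x * x) e) (cong (λ b → (x * x + b) * (x * x + b)) (sym eq))))
      where
      lemma₀ : ∀ x y → 4 * (x * y) * (4 * (x * y)) ≡ 4 * (x * x * (4 * (y * y)))
      lemma₀ = solve-∀
      lemma : ∀ a e → e * e + 4 * (a * (a + e)) ≡ (a + (a + e)) * (a + (a + e))
      lemma = solve-∀
    ... | tri> _ _ gt with e , 0<e , eq ← m<n⇒∃ gt = e , 4 * (x * y) , 0<e , *-mono-≤ (s≤s (z≤n {3}))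
          (*-mono-≤ 0<x 0<y)
      , trans (cong (_+_ (e * e)) (lemma₀ x y)) (trans (cong (λ a → e * e + 4 * (a * (4 * (y * y)))) eq)
          (trans (lemma (4 * (y * y)) e) (cong (λ a → (a + 4 * (y * y)) * (a + 4 * (y * y))) (sym eq))))
      where
      lemma₀ : ∀ x y → 4 * (x * y) * (4 * (x * y)) ≡ 4 * (x * x * (4 * (y * y)))
      lemma₀ = solve-∀
      lemma : ∀ b e → e * e + 4 * ((b + e) * b) ≡ (b + e + b) * (b + e + b)
      lemma = solve-∀
    ... | tri≈ _ eq _ = contradiction (odd-residue⇒odd {p} 2∤1 p%4≡1) (contradiction 2∣p)
      where
      2∣p : 2 ∣ p
      2∣p = divides (4 * (y * y)) (trans (cong (_+ 4 * (y * y)) eq) (lemma (4 * (y * y))))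
        where
        lemma : ∀ b → b + b ≡ b * 2
        lemma = solve-∀

  legs-distinct : ∀ {p d h} → Prime p → ¬ (2 ∣ p) → Legs p d h → d ≢ h
  legs-distinct {p} {d} pp odd (_ , _ , e) refl = odd
      (Sum.reduce (euclidsLemma p p prime[2] (divides (d * d) (trans (sym e) (lemma (d * d))))))
    where
    lemma : ∀ b → b + b ≡ b * 2
    lemma = solve-∀

  -- Two copies glued along h have area dh. Writing p = d + k turns Heron's formula into a
  -- polynomial identity, with h² = k(k + 2d).
  legs⇒heron : ∀ {p d h} → Legs p d h → IsHeron p p (2 * d)
  legs⇒heron {p} {d} {h} legs@(0<d , 0<h , e) =
    ((0<p , 0<p , 0<2d) , p<p+2d , p<p+2d , 2d<p+p) , d * h , *-mono-≤ 0<d 0<h , area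
    where
    d<p : d < p
    d<p = leg< {p} {d} {h} legs
    0<p : 0 < p
    0<p = ≤-trans 0<d (<⇒≤ d<p)
    0<2d : 0 < 2 * d
    0<2d = ≤-trans 0<d (m≤n*m d 2)
    p<p+2d : p < p + 2 * d
    p<p+2d = m<m+n p 0<2d
    2d<p+p : 2 * d < p + p
    2d<p+p = <-≤-trans (*-monoʳ-< 2 d<p) (≤-reflexive (cong (_+_ p) (+-identityʳ p)))
    k : ℕ
    k = p ∸ d
    p≡d+k : p ≡ d + k
    p≡d+k = sym (m+[n∸m]≡n (<⇒≤ d<p))
    h²≡ : h * h ≡ k * k + 2 * d * k
    h²≡ = +-cancelˡ-≡ (d * d) _ _ (trans e (trans (cong (λ p → p * p) p≡d+k) (lemma d k)))
      where
      lemma : ∀ d k → (d + k) * (d + k) ≡ d * d + (k * k + 2 * d * k)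
      lemma = solve-∀
    apex : p + p ∸ 2 * d ≡ 2 * k
    apex = trans (cong (_∸ 2 * d) (trans (cong (λ p → p + p) p≡d+k) (lemma d k))) (m+n∸m≡n (2 * d) (2 * k))
      where
      lemma : ∀ d k → d + k + (d + k) ≡ 2 * d + 2 * k
      lemma = solve-∀
    open ≡-Reasoning
    area : HasArea p p (2 * d) (d * h)
    area = begin
      16 * (d * h * (d * h))                              ≡⟨ lemma₁ d h ⟩
      16 * (d * d * (h * h))                              ≡⟨ cong (λ t → 16 * (d * d * t)) h²≡ ⟩
      16 * (d * d * (k * k + 2 * d * k))                  ≡⟨ lemma₂ d k ⟩
      (d + k + (d + k) + 2 * d) * (2 * d) * (2 * d) * (2 * k)
          ≡⟨ cong (λ p → (p + p + 2 * d) * (2 * d) * (2 * d) * (2 * k)) p≡d+k ⟨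
      (p + p + 2 * d) * (2 * d) * (2 * d) * (2 * k)
          ≡⟨ cong₂ (λ u v → (p + p + 2 * d) * u * u * v) (m+n∸m≡n p (2 * d)) apex ⟨
      sixteenAreaSquared p p (2 * d)                      ∎
      where
      lemma₁ : ∀ d h → 16 * (d * h * (d * h)) ≡ 16 * (d * d * (h * h))
      lemma₁ = solve-∀
      lemma₂ : ∀ d k → 16 * (d * d * (k * k + 2 * d * k)) ≡ (d + k + (d + k) + 2 * d) * (2 * d) * (2 * d) *
          (2 * k)
      lemma₂ = solve-∀

  -- This is A² = d²(p² - d²) without subtraction, obtained by eliminating x from 2x = 2p² - 4d² and
  -- x² + 4A² = p⁴.
  area-equation : ∀ {p d} (s : Solution p p (2 * d)) → let A = Solution.A s in
    d * d * (d * d) + A * A ≡ d * d * (p * p)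
  area-equation {p} {d} s = ℤ.+-injective (trans (cong₂ ℤ._+_ (pos-*⁴ d d) (ℤ.pos-* A A))
      (trans (ℤ.*-cancelˡ-≡ (ℤ.+ 16) _ _ scaled) (sym (pos-*⁴ d p))))
    where
    open Solution s
    D P : ℤ
    D = ℤ.+ d
    P = ℤ.+ p
    pos-*⁴ : ∀ m n → ℤ.+ (m * m * (n * n)) ≡ ℤ.+ m ℤ.* ℤ.+ m ℤ.* (ℤ.+ n ℤ.* ℤ.+ n)
    pos-*⁴ m n = trans (ℤ.pos-* (m * m) (n * n)) (cong₂ ℤ._*_ (ℤ.pos-* m m) (ℤ.pos-* n n))
    X : ℤ
    X = P ℤ.* P ℤ.+ P ℤ.* P ℤ.- ℤ.+ 2 ℤ.* D ℤ.* (ℤ.+ 2 ℤ.* D)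
    2x≡X : ℤ.+ 2 ℤ.* x ≡ X
    2x≡X = trans 2x≡ (cong (λ c → P ℤ.* P ℤ.+ P ℤ.* P ℤ.- c ℤ.* c) (ℤ.pos-* 2 d))
    lemma₁ : ∀ D A x → ℤ.+ 16 ℤ.* (D ℤ.* D ℤ.* (D ℤ.* D) ℤ.+ A ℤ.* A) ≡
      ℤ.+ 16 ℤ.* (D ℤ.* D ℤ.* (D ℤ.* D)) ℤ.+ ℤ.+ 4 ℤ.* (x ℤ.* x ℤ.+ ℤ.+ 2 ℤ.* A ℤ.* (ℤ.+ 2 ℤ.* A)) ℤ.- ℤ.+ 2
          ℤ.* x ℤ.* (ℤ.+ 2 ℤ.* x)
    lemma₁ = ℤ.solve-∀
    lemma₂ : ∀ P D → ℤ.+ 16 ℤ.* (D ℤ.* D ℤ.* (D ℤ.* D)) ℤ.+ ℤ.+ 4 ℤ.* (P ℤ.* P ℤ.* (P ℤ.* P)) ℤ.-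
        (P ℤ.* P ℤ.+ P ℤ.* P ℤ.- ℤ.+ 2 ℤ.* D ℤ.* (ℤ.+ 2 ℤ.* D)) ℤ.*
            (P ℤ.* P ℤ.+ P ℤ.* P ℤ.- ℤ.+ 2 ℤ.* D ℤ.* (ℤ.+ 2 ℤ.* D)) ≡
      ℤ.+ 16 ℤ.* (D ℤ.* D ℤ.* (P ℤ.* P))
    lemma₂ = ℤ.solve-∀
    open ≡-Reasoning
    scaled : ℤ.+ 16 ℤ.* (D ℤ.* D ℤ.* (D ℤ.* D) ℤ.+ ℤ.+ A ℤ.* ℤ.+ A) ≡ ℤ.+ 16 ℤ.* (D ℤ.* D ℤ.* (P ℤ.* P))
    scaled = begin
      ℤ.+ 16 ℤ.* (D ℤ.* D ℤ.* (D ℤ.* D) ℤ.+ ℤ.+ A ℤ.* ℤ.+ A)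
        ≡⟨ lemma₁ D (ℤ.+ A) x ⟩
      ℤ.+ 16 ℤ.* (D ℤ.* D ℤ.* (D ℤ.* D)) ℤ.+ ℤ.+ 4 ℤ.* (x ℤ.* x ℤ.+ y ℤ.* y) ℤ.- ℤ.+ 2 ℤ.* x ℤ.* (ℤ.+ 2 ℤ.* x)
        ≡⟨ cong₂ (λ u v → ℤ.+ 16 ℤ.* (D ℤ.* D ℤ.* (D ℤ.* D)) ℤ.+ ℤ.+ 4 ℤ.* u ℤ.- v ℤ.* v) norm 2x≡X ⟩
      ℤ.+ 16 ℤ.* (D ℤ.* D ℤ.* (D ℤ.* D)) ℤ.+ ℤ.+ 4 ℤ.* (P ℤ.* P ℤ.* (P ℤ.* P)) ℤ.- X ℤ.* X
        ≡⟨ lemma₂ P D ⟩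
      ℤ.+ 16 ℤ.* (D ℤ.* D ℤ.* (P ℤ.* P)) ∎

  -- The perimeter 2p + c is even, so c = 2d. By `area-equation` d² divides A², hence d divides A,
  -- and the quotient h is the altitude.
  heron⇒legs : ∀ {p c} → IsHeron p p c → ∃[ d ] ∃[ h ] (c ≡ 2 * d × Legs p d h)
  heron⇒legs {p} {c} heron@(((_ , _ , 0<c) , _) , _) = from-half (∣m+n∣m⇒∣n (Solution.2∣perimeter s) 2∣p+p)
    where
    s : Solution p p c
    s = heron⇒solution heron
    2∣p+p : 2 ∣ p + p
    2∣p+p = divides p (lemma p)
      where
      lemma : ∀ p → p + p ≡ p * 2
      lemma = solve-∀
    from-solution : ∀ {d} → 0 < d → Solution p p (2 * d) → ∃[ h ] Legs p d h
    from-solution {d} 0<d s = from-quotient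
        (m²∣n²⇒m∣n d A (∣m+n∣m⇒∣n (subst (d * d ∣_) (sym eq) (m∣m*n (p * p))) (m∣m*n (d * d))))
      where
      open Solution s using (A; 0<A)
      instance
        d≢0 : NonZero d
        d≢0 = >-nonZero 0<d
      eq : d * d * (d * d) + A * A ≡ d * d * (p * p)
      eq = area-equation {d = d} s
      lemma : ∀ d h → d * d * (d * d + h * h) ≡ d * d * (d * d) + h * d * (h * d)
      lemma = solve-∀
      from-quotient : d ∣ A → ∃[ h ] Legs p d h
      from-quotient (divides h A≡hd) = h , 0<d , n≢0⇒n>0 (λ { refl → <⇒≢ 0<A (sym A≡hd) })
        , *-cancelˡ-≡ _ _ (d * d) {{m*n≢0 d d}}
            (trans (lemma d h) (trans (cong (λ A → d * d * (d * d) + A * A) (sym A≡hd)) eq))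
    from-half : 2 ∣ c → ∃[ d ] ∃[ h ] (c ≡ 2 * d × Legs p d h)
    from-half (divides d c≡d2) = d , proj₁ legs , c≡2d , proj₂ legs
      where
      c≡2d : c ≡ 2 * d
      c≡2d = trans c≡d2 (*-comm d 2)
      legs : ∃[ h ] Legs p d h
      legs = from-solution (n≢0⇒n>0 λ { refl → <⇒≢ 0<c (sym c≡d2) }) (subst (Solution p p) c≡2d s)

  -- A leg is positive and less than p, hence prime to p. So `relative-sign` applies, and its sign
  -- feeds `same-or-swapped` with N = p; the swapped case d² = h′² means h² = d′².
  legs-unique : ∀ {p d h d′ h′} → Prime p → ¬ (2 ∣ p) → Legs p d h → Legs p d′ h′ → d′ ≡ d ⊎ d′ ≡ h
  legs-unique {p} {d} {h} {d′} {h′} pp odd l@(0<d , 0<h , e) l′@(0<d′ , 0<h′ , e′) =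
    let σ , p²∣ = relative-sign pp odd D K D′ K′ (p∤ l) (p∤ l′) (p²∣norm l) (p²∣norm l′)
    in Sum.map square≡ (λ D²≡K′² → square≡ (swapped D²≡K′²))
        (same-or-swapped P {{prime⇒nonZero pp}} σ D K D′ K′ (norm l) (norm l′) p²∣)
    where
    P D K D′ K′ : ℤ
    P = ℤ.+ p
    D = ℤ.+ d
    K = ℤ.+ h
    D′ = ℤ.+ d′
    K′ = ℤ.+ h′
    p∤ : ∀ {a b} → Legs p a b → ¬ (P ℤ.∣ ℤ.+ a)
    p∤ {a} {b} l@(0<a , _) p∣a = >⇒∤ {{>-nonZero 0<a}} (leg< {p} {a} {b} l) (ℤ.∣⇒∣ᵤ p∣a)
    norm : ∀ {a b} → Legs p a b → ℤ.+ a ℤ.* ℤ.+ a ℤ.+ ℤ.+ b ℤ.* ℤ.+ b ≡ P ℤ.* P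
    norm {a} {b} (_ , _ , e) = trans (sym (cong₂ ℤ._+_ (ℤ.pos-* a a) (ℤ.pos-* b b)))
        (trans (cong ℤ.+_ e) (ℤ.pos-* p p))
    p²∣norm : ∀ {a b} → Legs p a b → P ℤ.* P ℤ.∣ ℤ.+ a ℤ.* ℤ.+ a ℤ.+ ℤ.+ b ℤ.* ℤ.+ b
    p²∣norm l = ℤ.∣-reflexive (sym (norm l))
    square≡ : ∀ {a b} → ℤ.+ a ℤ.* ℤ.+ a ≡ ℤ.+ b ℤ.* ℤ.+ b → b ≡ a
    square≡ {a} {b} eq = square-injective b a
        (sym (ℤ.+-injective (trans (ℤ.pos-* a a) (trans eq (sym (ℤ.pos-* b b))))))
    swapped : D ℤ.* D ≡ K′ ℤ.* K′ → K ℤ.* K ≡ D′ ℤ.* D′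
    swapped eq = ∙-cancelˡ (D ℤ.* D) _ _
        (trans (norm l) (trans (sym (norm l′))
            (trans (ℤ.+-comm (D′ ℤ.* D′) (K′ ℤ.* K′)) (cong (ℤ._+ D′ ℤ.* D′) (sym eq)))))

  -- The third sides are 2d and 2h, the two ways of doubling the one right triangle with hypotenuse
  -- p; they differ because d ≠ h.
  H≡2 : ∀ {p} → Prime p → p % 4 ≡ 1 → H p p ≡ 2
  H≡2 {p} pp p%4≡1 = from-legs (legs-exist pp p%4≡1)
    where
    odd : ¬ (2 ∣ p)
    odd = odd-residue⇒odd {p} 2∤1 p%4≡1
    from-legs : ∃[ d ] ∃[ h ] Legs p d h → H p p ≡ 2
    from-legs (d , h , l) = ≤-antisym
      (length-≤-by-⊆ (thirdSides-unique p p)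
          (λ {c} c∈ → double (heron⇒legs (Equivalence.to (thirdSides-correct p p c) c∈))))
      (length-≤-by-⊆ ((2d≢2h ∷ []) ∷ [] ∷ []) doubles⊆)
      where
      2d≢2h : 2 * d ≢ 2 * h
      2d≢2h = legs-distinct pp odd l ∘ *-cancelˡ-≡ d h 2
      double : ∀ {c} → ∃[ d′ ] ∃[ h′ ] (c ≡ 2 * d′ × Legs p d′ h′) → c ∈ 2 * d ∷ 2 * h ∷ []
      double (d′ , h′ , refl , l′) = Sum.[ here ∘ cong (2 *_) , there ∘ here ∘ cong (2 *_) ]
          (legs-unique pp odd l l′)
      doubles⊆ : ∀ {c} → c ∈ 2 * d ∷ 2 * h ∷ [] → c ∈ thirdSides p p
      doubles⊆ (here refl) = Equivalence.from (thirdSides-correct p p (2 * d)) (legs⇒heron l)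
      doubles⊆ (there (here refl)) = Equivalence.from (thirdSides-correct p p (2 * h))
          (legs⇒heron (legs-sym {p} {d} {h} l))

open Residues using (odd-residue⇒odd; 2∤1)
open UnequalPrimes using (H≡0; H≤2; module DistinctOddPrimes)
open EqualPrimes using (H≡2)

theorem2p4 : (p q : ℕ) → Prime p → Prime q →
    (p % 4 ≡ 3 → q % 4 ≡ 3 → H p q ≡ 0)
    × (p ≡ q → q % 4 ≡ 1 → H p q ≡ 2)
    × (p ≢ q → (p % 4 ≡ 3 × q % 4 ≢ 3) ⊎ (p % 4 ≢ 3 × q % 4 ≡ 3) → H p q ≤ 2)
    × (p ≢ q → p % 4 ≡ 1 → q % 4 ≡ 1 → H p q ≤ 5)
theorem2p4 p q pp pq =
    H≡0 pp pq
  , (λ { refl q≡1 → H≡2 pq q≡1 })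
  , (λ { _ (inj₁ (p≡3 , _)) → H≤2 pp pq (inj₁ p≡3)
       ; _ (inj₂ (_ , q≡3)) → H≤2 pp pq (inj₂ q≡3) })
  , λ p≢q p≡1 q≡1 → DistinctOddPrimes.H≤5 pp pq p≢q
      (odd-residue⇒odd {p} 2∤1 p≡1) (odd-residue⇒odd {q} 2∤1 q≡1)
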